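{- Let $s\ge 1$, $n\ge 1$ and $i\ge 0$ be integers. Let $P_i(s,n)$ be the set of pairs $(D,R)$ where $D$ is a dissection of a convex $(sn+2)$-gon by $i$ pairwise non-crossing diagonals into polygons each having $sj+2$ sides for some $1\le j\le n-1$, and $R$ is one of the regions of $D$. Then there is a bijection between $P_i(s,n)$ and the Cartesian product of the set of all integer sequences $1\le a_1\le a_2\le\dots\le a_i\le sn+2$ and the set of all sequences $(\epsilon_1,\dots,\epsilon_{n-1})\in\{0,1\}^{n-1}$ with exactly $i$ entries equal to $1$.
   Context: The vertices $v_1,\dots,v_{sn+2}$ of the convex polygon are labeled cyclically anti-clockwise. A dissection by $i$ non-crossing diagonals divides the polygon into $i+1$ regions; the specified region $R$ is called the base region.
   Formalization: The range 1 ≤ j ≤ n−1 is replaced by 1 ≤ j ≤ n: for i = 0 the only region is the whole (sn+2)-gon (j = n), so as stated P_0(s,n) would be empty while the product has one element; for i ≥ 1 the two ranges give the same set. -}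

module Defs where

open import Data.Nat using (ℕ; zero; suc; _+_; _*_; _∸_)
  renaming (_≤_ to _≤ℕ_; _<_ to _<ℕ_)
open import Data.Fin using (Fin; toℕ; _<_; _≤_)
open import Data.Fin.Subset using (Subset; _∈_; ∣_∣)
open import Data.Vec using (Vec; lookup; []; _∷_)
open import Data.Bool using (Bool; true; false; T)
open import Data.Product using (_×_; Σ; ∃)
open import Data.Sum using (_⊎_)
open import Relation.Nullary using (¬_)
open import Relation.Binary.PropositionalEquality using (_≡_)
open import Data.Refinement using (Refinement)

-- Vertices of the convex m-gon are Fin m (vertex v_{k+1} is k), in cyclic
-- anticlockwise order.  A segment between vertices x < y is a polygon side
-- iff y = x + 1 or (x = 0 and y = m - 1); otherwise it is a diagonal.

IsPolygonSide : {m : ℕ} → Fin m → Fin m → Set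
IsPolygonSide {m} x y =
  (toℕ y ≡ suc (toℕ x)) ⊎ ((toℕ x ≡ 0) × (suc (toℕ y) ≡ m))

IsDiagonal : {m : ℕ} → Fin m → Fin m → Set
IsDiagonal x y = (x < y) × ¬ IsPolygonSide x y

Cross : {m : ℕ} → Fin m → Fin m → Fin m → Fin m → Set
Cross a b c d = (a < c × c < b × b < d) ⊎ (c < a × a < d × d < b)

-- A set of segments, encoded as an m × m Boolean table; entry (x , y)
-- true means the segment {x , y} (stored with x < y) is present.
SegmentSet : ℕ → Set
SegmentSet m = Vec (Vec Bool m) m

_∋ₛ_─_ : {m : ℕ} → SegmentSet m → Fin m → Fin m → Set
D ∋ₛ x ─ y = T (lookup (lookup D x) y)

countTrue : {k : ℕ} → Vec Bool k → ℕ
countTrue [] = 0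
countTrue (true ∷ v) = suc (countTrue v)
countTrue (false ∷ v) = countTrue v

size : {m : ℕ} → SegmentSet m → ℕ
size D = go D
  where
  go : {k m : ℕ} → Vec (Vec Bool m) k → ℕ
  go [] = 0
  go (r ∷ rs) = countTrue r + go rs

IsDissection : (m i : ℕ) → SegmentSet m → Set
IsDissection m i D =
  (∀ x y → D ∋ₛ x ─ y → IsDiagonal x y)
  × (∀ a b c d → D ∋ₛ a ─ b → D ∋ₛ c ─ d → ¬ Cross a b c d)
  × size D ≡ i

-- For a vertex set S and x < y in S, the segment {x , y} is a side of the
-- convex polygon spanned by S iff all of S lies weakly on one side of it:
-- either no vertex of S lies strictly between x and y, or all of S lies
-- in [x , y].
IsSideOf : {m : ℕ} → Subset m → Fin m → Fin m → Set
IsSideOf S x y =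
  (∀ z → z ∈ S → (z ≤ x ⊎ y ≤ z))
  ⊎ (∀ z → z ∈ S → (x ≤ z × z ≤ y))

-- A region of the dissection D: a polygon with vertex set S (at least
-- three vertices) whose sides are all polygon sides or diagonals of D, and
-- such that every diagonal of D joining two vertices of S is a side of it
-- (so no diagonal of D runs through its interior).  Its number of sides
-- is ∣ S ∣.
IsRegion : {m : ℕ} → SegmentSet m → Subset m → Set
IsRegion D S =
  (3 ≤ℕ ∣ S ∣)
  × (∀ x y → x ∈ S → y ∈ S → x < y →
       (IsSideOf S x y → IsPolygonSide x y ⊎ D ∋ₛ x ─ y)
       × (D ∋ₛ x ─ y → IsSideOf S x y))

P : (s n i : ℕ) → Set
P s n i =
  Refinement (SegmentSet (s * n + 2) × Subset (s * n + 2))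
    (λ DR → let D = Data.Product.proj₁ DR ; R = Data.Product.proj₂ DR in
      IsDissection (s * n + 2) i D
      × (∀ S → IsRegion D S →
           Σ ℕ λ j → (1 ≤ℕ j) × (j ≤ℕ n) × (∣ S ∣ ≡ s * j + 2))
      × IsRegion D R)

WeakSeq : (i m : ℕ) → Set
WeakSeq i m =
  Refinement (Vec ℕ i)
    (λ a → (∀ k → (1 ≤ℕ lookup a k) × (lookup a k ≤ℕ m))
         × (∀ k l → k ≤ l → lookup a k ≤ℕ lookup a l))

BinSeq : (n i : ℕ) → Set
BinSeq n i = Refinement (Vec Bool (n ∸ 1)) (λ ε → countTrue ε ≡ i)

{-# OPTIONS --safe #-}
module Submission where

-- A dissection is the plane tree dual to it, rooted at the side v₁─v_{sn+2}:
-- the leaves are the other sides, the inner nodes are the regions.  Choosing a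
-- region R cuts the preorder word of the tree as u N v, N being the letter of R.
-- By the cycle lemma every word w with the right numbers of letters has exactly
-- one splitting w = v u for which u N v is the preorder word of a tree.  Hence
-- (D , R) amounts to the label of R and the arbitrary word v u.  In v u, the
-- positions of the nodes among the leaves are the aₖ, and the labels, together
-- with that of R, form a composition of n, that is, the sequence ε.

open import Defs
open import Data.Nat
open import Data.Nat.Properties
open import Algebra.Properties.CommutativeSemigroup +-commutativeSemigroup using (interchange)
open import Data.Bool using (Bool; true; false; T)
open import Data.Bool.Properties using (T?)
open import Data.Empty using (⊥; ⊥-elim)
open import Data.Fin using (Fin; toℕ; fromℕ<; zero; suc)
import Data.Fin as F
import Data.Fin.Properties as Finₚ
open import Data.Fin.Subset using (Subset; ∣_∣; ⁅_⁆; _∪_) renaming (_∈_ to _∈ₛ_; ⊥ to ∅)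
open import Data.Fin.Subset.Properties
  using (_∈?_; nonempty?; p⊆q⇒∣p∣≤∣q∣; ∣⊥∣≡0; ∣⁅x⁆∣≡1; x∈p∪q⁺; x∈⁅x⁆; anySubset?)
open import Data.Irrelevant using ([_])
open import Data.List using (List; []; _∷_; _++_)
open import Data.List.Membership.Propositional using () renaming (_∈_ to _∈ˡ_)
open import Data.List.Membership.Propositional.Properties using (∈-∃++; ∈-++⁺ˡ; ∈-++⁺ʳ; ∈-++⁻)
open import Data.List.Properties using (++-assoc; ++-cancelˡ; ++-identityʳ; ∷-injective)
open import Data.List.Relation.Unary.Any using (here; there)
open import Data.Maybe using (Maybe; just; nothing)
open import Data.Maybe.Properties using (just-injective)
open import Data.Product
open import Data.Refinement as Refinement using (Refinement; value)
open import Data.Sum using (_⊎_; inj₁; inj₂; [_,_]′)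
open import Data.Unit using (tt)
open import Data.Vec using (Vec; []; _∷_; lookup; here; there; tabulate)
open import Data.Vec.Properties using ([]=⇒lookup; lookup⇒[]=; lookup∘tabulate; tabulate∘lookup; tabulate-cong)
open import Function using (id)
open import Function.Bundles using (_⤖_; mk⤖)
open import Relation.Binary.PropositionalEquality
open import Relation.Nullary
open import Relation.Nullary.Decidable
  using (_×-dec_; _⊎-dec_; _→-dec_; ⌊_⌋; toWitness; fromWitness; decidable-stable; map′; recompute)

-- A region with `s * j + 2` sides is a node with `s * j + 1` children: it raises the number of
-- trees owed by `s * j`, while a leaf lowers it by one. A single tree with `s * n + 1` leaves
-- therefore forces the values `j` to sum to `n`. This is why the `i + 1` regions give a composition
-- of `n`, coded by `i` ones among `n - 1` entries. The same leaves leave `s * n + 2` places for the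
-- remaining `i` nodes, and several nodes may share a place, so the positions increase only weakly.
-- The geometric obstacle is the notion of region: a condition on an arbitrary set of vertices, not
-- a piece obtained by cutting. It must be shown that such a set consists of the corners of exactly
-- one node. The side joining the first and the last vertex is added as a root for this purpose, so
-- that no region is exceptional. The bijection is given by its graph, a relation that is total and
-- single-valued in both directions; neither map has to be composed with the other.

-- Preorder words and the cycle lemma

Word : Set
Word = List (Maybe ℕ)

leaves : Word → ℕ
leaves [] = 0
leaves (nothing ∷ w) = suc (leaves w)
leaves (just a ∷ w) = leaves w

nodes : Word → ℕ
nodes [] = 0
nodes (nothing ∷ w) = nodes w
nodes (just a ∷ w) = suc (nodes w)

-- A letter `just a` is a node with `2 + a` children. It settles one debt and opens `2 + a` new
-- ones, so `suc a` is its net contribution.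
weight : Word → ℕ
weight [] = 0
weight (nothing ∷ w) = weight w
weight (just a ∷ w) = suc a + weight w

-- Run k w e: reading w as a preorder traversal that still owes k trees
-- leaves e trees owed.  The debt is positive before every letter.
data Run : ℕ → Word → ℕ → Set where
  done : ∀ {k} → Run k [] k
  leaf : ∀ {k w e} → Run k w e → Run (suc k) (nothing ∷ w) e
  node : ∀ {k a w e} → Run (2 + a + k) w e → Run (suc k) (just a ∷ w) e

leaves-++ : ∀ u v → leaves (u ++ v) ≡ leaves u + leaves v
leaves-++ [] v = refl
leaves-++ (nothing ∷ u) v = cong suc (leaves-++ u v)
leaves-++ (just a ∷ u) v = leaves-++ u v

nodes-++ : ∀ u v → nodes (u ++ v) ≡ nodes u + nodes v
nodes-++ [] v = refl
nodes-++ (nothing ∷ u) v = nodes-++ u v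
nodes-++ (just a ∷ u) v = cong suc (nodes-++ u v)

weight-++ : ∀ u v → weight (u ++ v) ≡ weight u + weight v
weight-++ [] v = refl
weight-++ (nothing ∷ u) v = weight-++ u v
weight-++ (just a ∷ u) v =
  trans (cong (suc a +_) (weight-++ u v)) (sym (+-assoc (suc a) (weight u) (weight v)))

Run-lift : ∀ {k w e} c → Run k w e → Run (k + c) w (e + c)
Run-lift c done = done
Run-lift c (leaf r) = leaf (Run-lift c r)
Run-lift {suc k} {_} {e} c (node {a = a} {w} r) =
  node (subst (λ t → Run (2 + t) w (e + c)) (+-assoc a k c) (Run-lift c r))

Run-++ : ∀ {k u v e f} → Run k u e → Run e v f → Run k (u ++ v) f
Run-++ done s = s
Run-++ (leaf r) s = leaf (Run-++ r s)
Run-++ (node r) s = node (Run-++ r s)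

Run-split : ∀ {k v f} u → Run k (u ++ v) f → ∃ λ e → Run k u e × Run e v f
Run-split [] r = _ , done , r
Run-split (nothing ∷ u) (leaf r) = let e , p , q = Run-split u r in e , leaf p , q
Run-split (just a ∷ u) (node r) = let e , p , q = Run-split u r in e , node p , q

Run-det : ∀ {k w e f} → Run k w e → Run k w f → e ≡ f
Run-det done done = refl
Run-det (leaf r) (leaf s) = Run-det r s
Run-det (node r) (node s) = Run-det r s

Run-weight : ∀ {k w e} → Run k w e → e + leaves w ≡ k + weight w
Run-weight done = refl
Run-weight {e = e} (leaf {w = w} r) = trans (+-suc e (leaves w)) (cong suc (Run-weight r))
Run-weight {suc k} (node {a = a} {w} r) = trans (Run-weight r) (cong suc (begin
  suc a + k + weight w   ≡⟨ cong (_+ weight w) (+-comm (suc a) k) ⟩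
  k + suc a + weight w   ≡⟨ +-assoc k (suc a) (weight w) ⟩
  k + (suc a + weight w) ∎))
  where open ≡-Reasoning

-- Levi's lemma of the free monoid.
++-compare : ∀ {A : Set} (v : List A) {u v′ u′} → v ++ u ≡ v′ ++ u′ →
  (∃ λ t → v′ ≡ v ++ t × u ≡ t ++ u′) ⊎ (∃ λ t → v ≡ v′ ++ t × u′ ≡ t ++ u)
++-compare [] {v′ = v′} eq = inj₁ (v′ , refl , eq)
++-compare (x ∷ v) {v′ = []} eq = inj₂ (x ∷ v , refl , sym eq)
++-compare (x ∷ v) {v′ = y ∷ v′} eq with ∷-injective eq
... | refl , eq′ with ++-compare v eq′
...   | inj₁ (t , p , q) = inj₁ (t , cong (x ∷_) p , q)
...   | inj₂ (t , p , q) = inj₂ (t , cong (x ∷_) p , q)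

Run-nonempty : ∀ {k x w e} → Run k (x ∷ w) e → 1 ≤ k
Run-nonempty (leaf r) = s≤s z≤n
Run-nonempty (node r) = s≤s z≤n

++∷-nonempty : ∀ {k e x v} u → Run k (u ++ x ∷ v) e → 1 ≤ k
++∷-nonempty [] r = Run-nonempty r
++∷-nonempty (_ ∷ u) r = Run-nonempty r

-- If both ran to 0, the debt left by x ∷ t would be e ≥ 1; starting s with e
-- instead of 1 would then not lower its final debt, which is positive.
rotations-not-both : ∀ {x} t {s} → (∀ {k e} → Run k s e → 1 ≤ k) →
  Run 1 (x ∷ t ++ s) 0 → ¬ Run 1 (s ++ x ∷ t) 0
rotations-not-both {x} t {s} ne r r′ with Run-split (x ∷ t) r | Run-split s r′
... | e , p , q | f , p′ , q′ with ne q
...   | s≤s {n = c} z≤n with Run-det q (Run-lift c p′) | Run-nonempty q′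
...     | () | s≤s z≤n

-- If the cuts differ by a nonempty piece `x ∷ t`, the two tree words arise from one another by
-- moving this piece from the front to the back. The letter `just a` makes the other piece nonempty
-- too, so `rotations-not-both` applies.
split-unique : ∀ {a v u v′ u′} → v ++ u ≡ v′ ++ u′ →
  Run 1 (u ++ just a ∷ v) 0 → Run 1 (u′ ++ just a ∷ v′) 0 → v ≡ v′ × u ≡ u′
split-unique {a} {v} {u} {v′} {u′} eq r r′ with ++-compare v eq
... | inj₁ ([] , p , q) = sym (trans p (++-identityʳ v)) , q
... | inj₁ (x ∷ t , refl , refl) = ⊥-elim (rotations-not-both t (++∷-nonempty u′)
        (subst (λ w → Run 1 w 0) (++-assoc (x ∷ t) u′ (just a ∷ v)) r)
        (subst (λ w → Run 1 w 0) (sym (++-assoc u′ (just a ∷ v) (x ∷ t))) r′))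
... | inj₂ ([] , p , q) = trans p (++-identityʳ v′) , sym q
... | inj₂ (x ∷ t , refl , refl) = ⊥-elim (rotations-not-both t (++∷-nonempty u)
        (subst (λ w → Run 1 w 0) (++-assoc (x ∷ t) u (just a ∷ v′)) r′)
        (subst (λ w → Run 1 w 0) (sym (++-assoc u (just a ∷ v′) (x ∷ t))) r))

-- The split is at the first minimum of the height function of w.
first-minimum : ∀ w → ∃ λ A → ∃ λ B → ∃ λ d → ∃ λ e → w ≡ A ++ B × Run d A 0 × Run 1 B e
first-minimum [] = [] , [] , 0 , 1 , refl , done , done
first-minimum (nothing ∷ w) with first-minimum w
... | A , B , d , e , eq , p , q = nothing ∷ A , B , suc d , e , cong (nothing ∷_) eq , leaf p , q
first-minimum (just a ∷ w) with first-minimum w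
... | A , B , d , e , eq , p , q with d ≤? suc a
-- The rise by `suc a` makes up for the later descent by `d`, so the height never falls below its
-- start: the first minimum moves to the beginning, also in case of a tie.
...   | yes d≤ = [] , just a ∷ w , 0 , _ , refl , done , node (subst₂ (λ k v → Run k v (e + (suc a ∸ d)))
          (trans (+-suc d (suc a ∸ d))
            (trans (cong suc (m+[n∸m]≡n d≤)) (cong (2 +_) (sym (+-identityʳ a)))))
          (sym eq)
          (Run-++ (Run-lift (suc (suc a ∸ d)) p) (Run-lift (suc a ∸ d) q)))
...   | no d≰ = just a ∷ A , B , suc (d ∸ (2 + a)) , e , cong (just a ∷_) eq ,
          node (subst (λ k → Run k A 0) (sym (m+[n∸m]≡n (≰⇒> d≰))) p) , q

-- By hypothesis the height of `just a ∷ w` drops by one in total. So the debt `e` left by the part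
-- `B` after the first minimum is just the debt `d` that the part `A` before it pays off, and the
-- rotation `B ++ A` is a tree word.
cycle-lemma : ∀ a w → leaves w ≡ 2 + a + weight w →
  ∃ λ v → ∃ λ u → w ≡ v ++ u × Run 1 (u ++ just a ∷ v) 0
cycle-lemma a w h with first-minimum (just a ∷ w)
... | A , B , d , e , eq , p , q = split A eq (Run-++ q (subst (λ k → Run k A 0) d≡e p))
  where
  open ≡-Reasoning
  d≡e : d ≡ e
  d≡e = +-cancelʳ-≡ (suc (weight A + weight B)) d e (begin
    d + suc (weight A + weight B)    ≡⟨ +-suc d _ ⟩
    suc (d + (weight A + weight B))  ≡⟨ cong suc (sym (+-assoc d _ _)) ⟩
    suc (d + weight A + weight B)    ≡⟨ cong (λ t → suc (t + weight B)) (sym (Run-weight p)) ⟩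
    suc (leaves A + weight B)        ≡⟨ sym (+-suc (leaves A) _) ⟩
    leaves A + suc (weight B)        ≡⟨ cong (leaves A +_) (sym (Run-weight q)) ⟩
    leaves A + (e + leaves B)        ≡⟨ sym (+-assoc (leaves A) e (leaves B)) ⟩
    leaves A + e + leaves B          ≡⟨ cong (_+ leaves B) (+-comm (leaves A) e) ⟩
    e + leaves A + leaves B          ≡⟨ +-assoc e _ _ ⟩
    e + (leaves A + leaves B)        ≡⟨ cong (e +_) (sym (leaves-++ A B)) ⟩
    e + leaves (A ++ B)              ≡⟨ cong (λ t → e + leaves t) (sym eq) ⟩
    e + leaves w                     ≡⟨ cong (e +_) h ⟩
    e + suc (weight (just a ∷ w))    ≡⟨ cong (λ t → e + suc (weight t)) eq ⟩
    e + suc (weight (A ++ B))        ≡⟨ cong (λ t → e + suc t) (weight-++ A B) ⟩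
    e + suc (weight A + weight B)    ∎)
  split : ∀ A {B} → just a ∷ w ≡ A ++ B → Run 1 (B ++ A) 0 →
    ∃ λ v → ∃ λ u → w ≡ v ++ u × Run 1 (u ++ just a ∷ v) 0
  -- With an empty `A` the word `just a ∷ w` is itself a tree word. Otherwise the chosen letter
  -- opens `A`, and `B` precedes it after the rotation.
  split [] refl r = w , [] , sym (++-identityʳ w) , subst (λ t → Run 1 t 0) (++-identityʳ _) r
  split (_ ∷ A) {B} refl r = A , B , refl , r

-- Plane forests and their preorder words

-- Forest x y k: k consecutive plane trees, the leaves of which are the sides
-- x─x+1, …, y-1─y.  A node spanning x, …, z is the region below the segment
-- x─z; it has 2 + a children, the other sides of the region.
data Forest : ℕ → ℕ → ℕ → Set where
  [] : ∀ {x} → Forest x x 0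
  leaf : ∀ {x y k} → Forest (suc x) y k → Forest x y (suc k)
  node : ∀ {x z y k} a → Forest x z (2 + a) → Forest z y k → Forest x y (suc k)

flat : ∀ {x y k} → Forest x y k → Word
flat [] = []
flat (leaf F) = nothing ∷ flat F
flat (node a G F) = just a ∷ flat G ++ flat F

-- An edge is at the same time a segment and the address of the node below it, so that the word
-- before the node, its label, the word after it and its children can all be read off the edge.
data Edge : ∀ {x y k} → Forest x y k → ℕ → ℕ → Set where
  here : ∀ {x z y k a} {G : Forest x z (2 + a)} {F : Forest z y k} → Edge (node a G F) x z
  below : ∀ {x z y k a c d} {G : Forest x z (2 + a)} {F : Forest z y k} →
    Edge G c d → Edge (node a G F) c d
  right : ∀ {x z y k a c d} {G : Forest x z (2 + a)} {F : Forest z y k} →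
    Edge F c d → Edge (node a G F) c d
  skip : ∀ {x y k c d} {F : Forest (suc x) y k} → Edge F c d → Edge (leaf F) c d

-- Only the ends of the roots are counted. On `sub e` these are the corners of the region below `e`.
On : ∀ {x y k} → Forest x y k → ℕ → Set
On {x} [] v = v ≡ x
On {x} (leaf F) v = v ≡ x ⊎ On F v
On {x} (node a G F) v = v ≡ x ⊎ On F v

pre : ∀ {x y k c d} {F : Forest x y k} → Edge F c d → Word
pre here = []
pre {F = node a G F} (below e) = just a ∷ pre e
pre {F = node a G F} (right e) = just a ∷ flat G ++ pre e
pre (skip e) = nothing ∷ pre e

label : ∀ {x y k c d} {F : Forest x y k} → Edge F c d → ℕ
label {F = node a G F} here = a
label (below e) = label e
label (right e) = label e
label (skip e) = label e

post : ∀ {x y k c d} {F : Forest x y k} → Edge F c d → Word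
post {F = node a G F} here = flat G ++ flat F
post {F = node a G F} (below e) = post e ++ flat F
post (right e) = post e
post (skip e) = post e

sub : ∀ {x y k c d} {F : Forest x y k} (e : Edge F c d) → Forest c d (2 + label e)
sub {F = node a G F} here = G
sub (below e) = sub e
sub (right e) = sub e
sub (skip e) = sub e

flat-Run : ∀ {x y k} (F : Forest x y k) m → Run (k + m) (flat F) m
flat-Run [] m = done
flat-Run (leaf F) m = leaf (flat-Run F m)
flat-Run (node {k = k} a G F) m =
  node (Run-++ (flat-Run G (k + m)) (flat-Run F m))

flat-Run₀ : ∀ {x y k} (F : Forest x y k) → Run k (flat F) 0
flat-Run₀ {k = k} F = subst (λ j → Run j (flat F) 0) (+-identityʳ k) (flat-Run F 0)

flat-leaves : ∀ {x y k} (F : Forest x y k) → x + leaves (flat F) ≡ y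
flat-leaves [] = +-identityʳ _
flat-leaves {x} (leaf F) = trans (+-suc x _) (flat-leaves F)
flat-leaves {x} (node {z = z} a G F) = begin
  x + leaves (flat G ++ flat F)            ≡⟨ cong (x +_) (leaves-++ (flat G) _) ⟩
  x + (leaves (flat G) + leaves (flat F))  ≡⟨ sym (+-assoc x _ _) ⟩
  x + leaves (flat G) + leaves (flat F)    ≡⟨ cong (_+ leaves (flat F)) (flat-leaves G) ⟩
  z + leaves (flat F)                      ≡⟨ flat-leaves F ⟩
  _                                        ∎
  where open ≡-Reasoning

split-forest : ∀ {x y k} m (F : Forest x y (m + k)) →
  ∃ λ z → Σ (Forest x z m) λ G → Σ (Forest z y k) λ H → flat F ≡ flat G ++ flat H
split-forest zero F = _ , [] , F , refl
split-forest (suc m) (leaf F) with split-forest m F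
... | z , G , H , eq = z , leaf G , H , cong (nothing ∷_) eq
split-forest (suc m) (node a K F) with split-forest m F
... | z , G , H , eq = z , node a K G , H ,
  cong (just a ∷_) (trans (cong (flat K ++_) eq) (sym (++-assoc (flat K) _ _)))

parse : ∀ x {k w} → Run k w 0 → ∃ λ y → Σ (Forest x y k) λ F → flat F ≡ w
parse x done = x , [] , refl
parse x (leaf r) with parse (suc x) r
... | y , F , eq = y , leaf F , cong (nothing ∷_) eq
parse x (node {a = a} r) with parse x r
-- The run after the letter gives the children and the later siblings in one row; the first `2 + a`
-- trees of it are the children.
... | y , F , refl with split-forest (2 + a) F
...   | z , G , H , eq = y , node a G H , cong (just a ∷_) (sym eq)

-- Such words form a prefix code: at debt zero no further letter can be read, so the end of the run
-- is visible in the word itself.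
Run-prefix : ∀ {k u u′ v v′} → Run k u 0 → Run k u′ 0 → u ++ v ≡ u′ ++ v′ → u ≡ u′ × v ≡ v′
Run-prefix done done eq = refl , eq
Run-prefix (leaf r) (leaf s) eq with Run-prefix r s (proj₂ (∷-injective eq))
... | refl , eq′ = refl , eq′
Run-prefix (node r) (node s) eq with ∷-injective eq
... | refl , eq₁ with Run-prefix r s eq₁
...   | refl , eq′ = refl , eq′
Run-prefix (leaf r) (node s) ()
Run-prefix (node r) (leaf s) ()

flat-injective : ∀ {x y k} (F F′ : Forest x y k) → flat F ≡ flat F′ → F ≡ F′
flat-injective [] [] eq = refl
flat-injective (leaf F) (leaf F′) eq = cong leaf (flat-injective F F′ (proj₂ (∷-injective eq)))
flat-injective {x} (node {z = z} a G F) (node {z = z′} a′ G′ F′) eq with ∷-injective eq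
... | refl , eq₁ with Run-prefix (flat-Run₀ G) (flat-Run₀ G′) eq₁
...   | p , q with trans (sym (flat-leaves G)) (trans (cong (λ w → x + leaves w) p) (flat-leaves G′))
...     | refl with flat-injective G G′ p | flat-injective F F′ q
...       | refl | refl = refl

flat-edge : ∀ {x y k c d} {F : Forest x y k} (e : Edge F c d) →
  flat F ≡ pre e ++ just (label e) ∷ post e
flat-edge here = refl
flat-edge {F = node a G F} (below e) = cong (just a ∷_)
  (trans (cong (_++ flat F) (flat-edge e)) (++-assoc (pre e) _ _))
flat-edge {F = node a G F} (right e) = cong (just a ∷_)
  (trans (cong (flat G ++_) (flat-edge e)) (sym (++-assoc (flat G) _ _)))
flat-edge (skip e) = cong (nothing ∷_) (flat-edge e)

flat-letter : ∀ {x y k} (F : Forest x y k) u {a v} → flat F ≡ u ++ just a ∷ v →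
  ∃ λ c → ∃ λ d → Σ (Edge F c d) λ e → pre e ≡ u × label e ≡ a × post e ≡ v
flat-letter [] [] ()
flat-letter [] (_ ∷ _) ()
flat-letter (leaf F) [] ()
flat-letter (leaf F) (_ ∷ u) eq with ∷-injective eq
... | refl , eq′ with flat-letter F u eq′
...   | c , d , e , refl , p , q = c , d , skip e , refl , p , q
flat-letter (node a G F) [] refl = _ , _ , here , refl , refl , refl
flat-letter (node b G F) (_ ∷ u) eq with ∷-injective eq
... | refl , eq′ with ++-compare (flat G) {v′ = u} eq′
...   | inj₁ (t , refl , p) with flat-letter F t p
...     | c , d , e , refl , q , r = c , d , right e , refl , q , r
flat-letter (node b G F) (_ ∷ u) eq | refl , eq′ | inj₂ ([] , p , q) with flat-letter F [] (sym q)
... | c , d , e , h , q′ , r = c , d , right e ,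
    cong (just b ∷_) (trans (cong (flat G ++_) h) (trans (++-identityʳ _) (trans p (++-identityʳ u)))) , q′ , r
flat-letter (node b G F) (_ ∷ u) eq | refl , eq′ | inj₂ (_ ∷ t , p , refl) with flat-letter G u p
... | c , d , e , h , q , r = c , d , below e , cong (just b ∷_) h , q , cong (_++ flat F) r

++-longer : ∀ (u : Word) {x v w} → u ≢ (u ++ x ∷ v) ++ w
++-longer (_ ∷ u) eq = ++-longer u (proj₂ (∷-injective eq))

-- The letter of a node of `G` stands within `flat G`, that of a node of `F` behind all of it;
-- `++-longer` tells the two cases apart.
pre-injective : ∀ {x y k c d c′ d′} {F : Forest x y k} (e : Edge F c d) (e′ : Edge F c′ d′) →
  pre e ≡ pre e′ → _≡_ {A = ∃₂ (Edge F)} (c , d , e) (c′ , d′ , e′)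
pre-injective here here eq = refl
pre-injective {F = node a G F} (below e) (below e′) eq
  with pre-injective e e′ (proj₂ (∷-injective eq))
... | refl = refl
pre-injective {F = node a G F} (right e) (right e′) eq
  with pre-injective e e′ (++-cancelˡ (flat G) _ _ (proj₂ (∷-injective eq)))
... | refl = refl
pre-injective (skip e) (skip e′) eq with pre-injective e e′ (proj₂ (∷-injective eq))
... | refl = refl
pre-injective {F = node a G F} (below e) (right e′) eq =
  ⊥-elim (++-longer (pre e) (trans (proj₂ (∷-injective eq)) (cong (_++ pre e′) (flat-edge e))))
pre-injective {F = node a G F} (right e) (below e′) eq =
  ⊥-elim (++-longer (pre e′) (trans (sym (proj₂ (∷-injective eq))) (cong (_++ pre e) (flat-edge e′))))

-- Spans, edges and upper boundary of a forest

forest-length : ∀ {x y k} → Forest x y k → x + k ≤ y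
forest-length {x} [] = ≤-reflexive (+-identityʳ x)
forest-length {x} (leaf {k = k} F) = ≤-trans (≤-reflexive (+-suc x k)) (forest-length F)
forest-length {x} (node {z = z} {k = k} a G F) = ≤-trans (≤-reflexive (+-suc x k))
  (≤-trans (+-monoˡ-≤ k (≤-trans (≤-trans (m≤m+n (suc x) (suc a)) (≤-reflexive (sym (+-suc x (suc a)))))
    (forest-length G))) (forest-length F))

forest-≤ : ∀ {x y k} → Forest x y k → x ≤ y
forest-≤ F = ≤-trans (m≤m+n _ _) (forest-length F)

forest-< : ∀ {x y k} → Forest x y (suc k) → x < y
forest-< {x} {k = k} F = ≤-trans (≤-trans (m≤m+n (suc x) k) (≤-reflexive (sym (+-suc x k)))) (forest-length F)

forest-<₂ : ∀ {x y k} → Forest x y (2 + k) → 2 + x ≤ y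
forest-<₂ (leaf F) = forest-< F
forest-<₂ (node a G F) = ≤-trans (s≤s (forest-< G)) (forest-< F)

edge-≥ : ∀ {x y k c d} {F : Forest x y k} → Edge F c d → x ≤ c
edge-≥ here = ≤-refl
edge-≥ (below e) = edge-≥ e
edge-≥ (right {G = G} e) = ≤-trans (forest-≤ G) (edge-≥ e)
edge-≥ (skip e) = ≤-trans (n≤1+n _) (edge-≥ e)

edge-≤ : ∀ {x y k c d} {F : Forest x y k} → Edge F c d → d ≤ y
edge-≤ (here {F = F}) = forest-≤ F
edge-≤ (below {F = F} e) = ≤-trans (edge-≤ e) (forest-≤ F)
edge-≤ (right e) = edge-≤ e
edge-≤ (skip e) = edge-≤ e

edge-<₂ : ∀ {x y k c d} {F : Forest x y k} → Edge F c d → 2 + c ≤ d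
edge-<₂ e = forest-<₂ (sub e)

edge-< : ∀ {x y k c d} {F : Forest x y k} → Edge F c d → c < d
edge-< e = ≤-trans (n≤1+n _) (edge-<₂ e)

-- Every tree covers at least one side, so none of two or more roots covers everything. As all nodes
-- have at least two children, this keeps the edge of a node distinct from all edges beneath it.
edge-proper : ∀ {x y k} {F : Forest x y (2 + k)} → ¬ Edge F x y
edge-proper (here {F = F}) = <-irrefl refl (forest-< F)
edge-proper (below {F = F} e) = <-irrefl refl (≤-trans (forest-< F) (edge-≤ e))
edge-proper (right {G = G} e) = <-irrefl refl (≤-trans (forest-< G) (edge-≥ e))
edge-proper (skip e) = <-irrefl refl (edge-≥ e)

edge-below-right : ∀ {x z y k l c d} {G : Forest x z k} {F : Forest z y l} →
  Edge G c d → ¬ Edge F c d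
edge-below-right e f = <-irrefl refl (≤-trans (edge-< e) (≤-trans (edge-≤ e) (edge-≥ f)))

edge-unique : ∀ {x y k c d} {F : Forest x y k} (e f : Edge F c d) → e ≡ f
edge-unique here here = refl
edge-unique here (below f) = ⊥-elim (edge-proper f)
edge-unique here (right {G = G} f) = ⊥-elim (<-irrefl refl (≤-trans (forest-< G) (edge-≥ f)))
edge-unique (below e) here = ⊥-elim (edge-proper e)
edge-unique (below e) (below f) = cong below (edge-unique e f)
edge-unique (below e) (right f) = ⊥-elim (edge-below-right e f)
edge-unique (right {G = G} e) here = ⊥-elim (<-irrefl refl (≤-trans (forest-< G) (edge-≥ e)))
edge-unique (right e) (below f) = ⊥-elim (edge-below-right f e)
edge-unique (right e) (right f) = cong right (edge-unique e f)
edge-unique (skip e) (skip f) = cong skip (edge-unique e f)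

edge? : ∀ {x y k} (F : Forest x y k) c d → Dec (Edge F c d)
edge? [] c d = no λ ()
edge? (leaf F) c d with edge? F c d
... | yes e = yes (skip e)
... | no ¬e = no λ { (skip e) → ¬e e }
edge? (node {x} {z} a G F) c d with c ≟ x | d ≟ z | edge? G c d | edge? F c d
... | yes refl | yes refl | _ | _ = yes here
... | _ | _ | yes e | _ = yes (below e)
... | _ | _ | _ | yes e = yes (right e)
... | no c≢x | _ | no ¬e | no ¬f = no λ { here → c≢x refl ; (below e) → ¬e e ; (right f) → ¬f f }
... | _ | no d≢z | no ¬e | no ¬f = no λ { here → d≢z refl ; (below e) → ¬e e ; (right f) → ¬f f }

edge-noncrossing : ∀ {x y k a b c d} {F : Forest x y k} → Edge F a b → Edge F c d →
  a < c → c < b → b < d → ⊥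
edge-noncrossing here here p q r = <-irrefl refl p
edge-noncrossing here (below f) p q r = <⇒≱ r (edge-≤ f)
edge-noncrossing here (right f) p q r = <⇒≱ q (edge-≥ f)
edge-noncrossing (below e) here p q r = <⇒≱ p (edge-≥ e)
edge-noncrossing (below e) (below f) p q r = edge-noncrossing e f p q r
edge-noncrossing (below e) (right f) p q r = <⇒≱ q (≤-trans (edge-≤ e) (edge-≥ f))
edge-noncrossing (right {G = G} e) here p q r = <⇒≱ p (≤-trans (forest-≤ G) (edge-≥ e))
edge-noncrossing (right e) (below f) p q r =
  <⇒≱ (<-trans p (<-trans q r)) (≤-trans (edge-≤ f) (edge-≥ e))
edge-noncrossing (right e) (right f) p q r = edge-noncrossing e f p q r
edge-noncrossing (skip e) (skip f) p q r = edge-noncrossing e f p q r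

on-left : ∀ {x y k} (F : Forest x y k) → On F x
on-left [] = refl
on-left (leaf F) = inj₁ refl
on-left (node a G F) = inj₁ refl

on-right : ∀ {x y k} (F : Forest x y k) → On F y
on-right [] = refl
on-right (leaf F) = inj₂ (on-right F)
on-right (node a G F) = inj₂ (on-right F)

on-≥ : ∀ {x y k v} (F : Forest x y k) → On F v → x ≤ v
on-≥ [] refl = ≤-refl
on-≥ (leaf F) (inj₁ refl) = ≤-refl
on-≥ (leaf F) (inj₂ p) = ≤-trans (n≤1+n _) (on-≥ F p)
on-≥ (node a G F) (inj₁ refl) = ≤-refl
on-≥ (node a G F) (inj₂ p) = ≤-trans (forest-≤ G) (on-≥ F p)

on-≤ : ∀ {x y k v} (F : Forest x y k) → On F v → v ≤ y
on-≤ [] refl = ≤-refl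
on-≤ (leaf F) (inj₁ refl) = <⇒≤ (forest-≤ F)
on-≤ (leaf F) (inj₂ p) = on-≤ F p
on-≤ (node a G F) (inj₁ refl) = ≤-trans (forest-≤ G) (forest-≤ F)
on-≤ (node a G F) (inj₂ p) = on-≤ F p

on? : ∀ {x y k} (F : Forest x y k) v → Dec (On F v)
on? {x} [] v = v ≟ x
on? {x} (leaf F) v with v ≟ x | on? F v
... | yes p | _ = yes (inj₁ p)
... | no _ | yes p = yes (inj₂ p)
... | no ¬p | no ¬q = no λ { (inj₁ p) → ¬p p ; (inj₂ q) → ¬q q }
on? {x} (node a G F) v with v ≟ x | on? F v
... | yes p | _ = yes (inj₁ p)
... | no _ | yes p = yes (inj₂ p)
... | no ¬p | no ¬q = no λ { (inj₁ p) → ¬p p ; (inj₂ q) → ¬q q }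

Between : (ℕ → Set) → ℕ → ℕ → Set
Between Q c d = ∀ v → Q v → v ≤ c ⊎ d ≤ v

-- An edge with both ends on the upper boundary is a root: one beneath a root stays within the span
-- of that root, and by `edge-proper` it does not reach both ends.
edge-on : ∀ {x y k c d} {F : Forest x y k} → Edge F c d → On F c → On F d → Between (On F) c d
edge-on here p q v (inj₁ refl) = inj₁ ≤-refl
edge-on (here {F = F}) p q v (inj₂ r) = inj₂ (on-≥ F r)
edge-on (below {F = F} e) (inj₁ refl) (inj₁ refl) v r = ⊥-elim (<-irrefl refl (edge-< e))
edge-on (below {F = F} e) (inj₁ refl) (inj₂ q) v r with ≤-antisym (edge-≤ e) (on-≥ F q)
... | refl = ⊥-elim (edge-proper e)
edge-on (below {F = F} e) (inj₂ p) q v r = ⊥-elim (<⇒≱ (edge-< e) (≤-trans (edge-≤ e) (on-≥ F p)))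
edge-on f@(right _) p q v (inj₁ refl) = inj₁ (edge-≥ f)
edge-on (right {G = G} e) (inj₁ refl) q v (inj₂ r) = ⊥-elim (<⇒≱ (forest-< G) (edge-≥ e))
edge-on (right {G = G} e) (inj₂ p) (inj₁ refl) v (inj₂ r) =
  ⊥-elim (<⇒≱ (edge-< e) (≤-trans (forest-≤ G) (edge-≥ e)))
edge-on (right e) (inj₂ p) (inj₂ q) v (inj₂ r) = edge-on e p q v r
edge-on f@(skip _) p q v (inj₁ refl) = inj₁ (edge-≥ f)
edge-on (skip e) (inj₁ refl) q v (inj₂ r) = ⊥-elim (<-irrefl refl (edge-≥ e))
edge-on (skip e) (inj₂ p) (inj₁ refl) v (inj₂ r) =
  ⊥-elim (<⇒≱ (edge-< e) (≤-trans (n≤1+n _) (edge-≥ e)))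
edge-on (skip e) (inj₂ p) (inj₂ q) v (inj₂ r) = edge-on e p q v r

on-consecutive : ∀ {x y k c d} (F : Forest x y k) → On F c → On F d → c < d → Between (On F) c d →
  d ≡ suc c ⊎ Edge F c d
on-consecutive [] refl refl c<d b = ⊥-elim (<-irrefl refl c<d)
on-consecutive (leaf F) (inj₁ refl) (inj₁ refl) c<d b = ⊥-elim (<-irrefl refl c<d)
on-consecutive (leaf F) (inj₁ refl) (inj₂ q) c<d b with b _ (inj₂ (on-left F))
... | inj₁ p = ⊥-elim (<-irrefl refl p)
... | inj₂ p = inj₁ (≤-antisym p c<d)
on-consecutive (leaf F) (inj₂ p) (inj₁ refl) c<d b = ⊥-elim (<⇒≱ c<d (≤-trans (n≤1+n _) (on-≥ F p)))
on-consecutive (leaf F) (inj₂ p) (inj₂ q) c<d b with on-consecutive F p q c<d (λ v r → b v (inj₂ r))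
... | inj₁ eq = inj₁ eq
... | inj₂ e = inj₂ (skip e)
on-consecutive (node a G F) (inj₁ refl) (inj₁ refl) c<d b = ⊥-elim (<-irrefl refl c<d)
on-consecutive (node a G F) (inj₁ refl) (inj₂ q) c<d b with b _ (inj₂ (on-left F))
... | inj₁ p = ⊥-elim (<⇒≱ (forest-< G) p)
... | inj₂ p with ≤-antisym p (on-≥ F q)
...   | refl = inj₂ here
on-consecutive (node a G F) (inj₂ p) (inj₁ refl) c<d b =
  ⊥-elim (<⇒≱ c<d (≤-trans (forest-≤ G) (on-≥ F p)))
on-consecutive (node a G F) (inj₂ p) (inj₂ q) c<d b with on-consecutive F p q c<d (λ v r → b v (inj₂ r))
... | inj₁ eq = inj₁ eq
... | inj₂ e = inj₂ (right e)

sub-edge : ∀ {x y k c d p q} {F : Forest x y k} (e : Edge F c d) → Edge (sub e) p q → Edge F p q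
sub-edge here f = below f
sub-edge (below e) f = below (sub-edge e f)
sub-edge (right e) f = right (sub-edge e f)
sub-edge (skip e) f = skip (sub-edge e f)

edge-sub : ∀ {x y k c d p q} {F : Forest x y k} (e : Edge F c d) → Edge F p q → c ≤ p → q ≤ d →
  (p ≡ c × q ≡ d) ⊎ Edge (sub e) p q
edge-sub here here i j = inj₁ (refl , refl)
edge-sub here (below f) i j = inj₂ f
edge-sub here (right f) i j = ⊥-elim (<⇒≱ (edge-< f) (≤-trans j (edge-≥ f)))
edge-sub (below e) here i j with ≤-antisym i (edge-≥ e) | ≤-antisym (edge-≤ e) j
... | refl | refl = ⊥-elim (edge-proper e)
edge-sub (below e) (below f) i j = edge-sub e f i j
edge-sub (below e) (right f) i j =
  ⊥-elim (<⇒≱ (edge-< f) (≤-trans j (≤-trans (edge-≤ e) (edge-≥ f))))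
edge-sub (right {G = G} e) here i j = ⊥-elim (<⇒≱ (forest-< G) (≤-trans (edge-≥ e) i))
edge-sub (right e) (below f) i j =
  ⊥-elim (<⇒≱ (edge-< f) (≤-trans (edge-≤ f) (≤-trans (edge-≥ e) i)))
edge-sub (right e) (right f) i j = edge-sub e f i j
edge-sub (skip e) (skip f) i j = edge-sub e f i j

first-edge : ∀ {x z y k a d} {G : Forest x z (2 + a)} {F : Forest z y k} →
  Edge (node a G F) x d → d ≤ z
first-edge here = ≤-refl
first-edge (below e) = edge-≤ e
first-edge (right {G = G} e) = ⊥-elim (<⇒≱ (forest-< G) (edge-≥ e))

-- The first tree is visible in the edges: it is a leaf if no edge starts at `x`, and otherwise its
-- root is the longest edge from `x`. The remaining edges then separate into those beneath this root
-- and those to its right.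
edges-determine : ∀ {x y k k′} (F : Forest x y k) (F′ : Forest x y k′) →
  (∀ {c d} → Edge F c d → Edge F′ c d) → (∀ {c d} → Edge F′ c d → Edge F c d) →
  _≡_ {A = ∃ (Forest x y)} (k , F) (k′ , F′)
edges-determine [] [] i j = refl
edges-determine [] (leaf F′) i j = ⊥-elim (<-irrefl refl (forest-≤ F′))
edges-determine [] F′@(node _ _ _) i j = ⊥-elim (<-irrefl refl (forest-< F′))
edges-determine (leaf F) [] i j = ⊥-elim (<-irrefl refl (forest-≤ F))
edges-determine F@(node _ _ _) [] i j = ⊥-elim (<-irrefl refl (forest-< F))
edges-determine (leaf F) (node _ _ _) i j with j here
... | skip e = ⊥-elim (<-irrefl refl (edge-≥ e))
edges-determine (node _ _ _) (leaf F′) i j with i here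
... | skip e = ⊥-elim (<-irrefl refl (edge-≥ e))
edges-determine (leaf F) (leaf F′) i j
  with edges-determine F F′ (λ e → unskip (i (skip e))) (λ e → unskip (j (skip e)))
  where
  unskip : ∀ {x y k c d} {F : Forest (suc x) y k} → Edge (leaf F) c d → Edge F c d
  unskip (skip e) = e
... | refl = refl
edges-determine (node a G F) (node a′ G′ F′) i j with ≤-antisym (first-edge (i here)) (first-edge (j here))
... | refl with edges-determine G G′ (below⁻ i) (below⁻ j) | edges-determine F F′ (right⁻ i) (right⁻ j)
  where
  below⁻ : ∀ {x z y k k′ a a′ c d} {G : Forest x z (2 + a)} {F : Forest z y k}
    {G′ : Forest x z (2 + a′)} {F′ : Forest z y k′} →
    (∀ {c d} → Edge (node a G F) c d → Edge (node a′ G′ F′) c d) → Edge G c d → Edge G′ c d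
  below⁻ i e with i (below e)
  ... | here = ⊥-elim (edge-proper e)
  ... | below e′ = e′
  ... | right e′ = ⊥-elim (edge-below-right e e′)
  right⁻ : ∀ {x z y k k′ a a′ c d} {G : Forest x z (2 + a)} {F : Forest z y k}
    {G′ : Forest x z (2 + a′)} {F′ : Forest z y k′} →
    (∀ {c d} → Edge (node a G F) c d → Edge (node a′ G′ F′) c d) → Edge F c d → Edge F′ c d
  right⁻ {G = G} i e with i (right e)
  ... | here = ⊥-elim (<⇒≱ (forest-< G) (edge-≥ e))
  ... | below e′ = ⊥-elim (edge-below-right e′ e)
  ... | right e′ = e′
...   | refl | refl = refl

-- From non-crossing segments to a forest

greatest : ∀ {Q : ℕ → Set} → (∀ v → Dec (Q v)) → ∀ {a} b → Q a → a < b →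
  ∃ λ t → Q t × a ≤ t × t < b × (∀ u → Q u → u < b → u ≤ t)
greatest Q? {a} (suc b) q (s≤s a≤b) with Q? b | a ≟ b
... | yes p | _ = b , p , a≤b , ≤-refl , λ { u _ (s≤s h) → h }
... | no ¬p | yes refl = ⊥-elim (¬p q)
... | no ¬p | no a≢b with greatest Q? b q (≤∧≢⇒< a≤b a≢b)
...   | t , r , i , j , m = t , r , i , m≤n⇒m≤1+n j , max
  where
  max : ∀ u → _ → u < suc b → u ≤ t
  max u p (s≤s u≤b) with u ≟ b
  ... | yes refl = ⊥-elim (¬p p)
  ... | no u≢b = m u p (≤∧≢⇒< u≤b u≢b)

-- The tree of a finite set of non-crossing segments: the first side of the
-- region below v─y is the longest segment starting at v other than v─y.
module Dissect (E : ℕ → ℕ → Set) (E? : ∀ c d → Dec (E c d))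
  (E-<₂ : ∀ {c d} → E c d → 2 + c ≤ d)
  (E-noncrossing : ∀ {a b c d} → E a b → E c d → a < c → c < b → b < d → ⊥) where

  Within Inside : ℕ → ℕ → ℕ → ℕ → Set
  Within v y c d = E c d × v ≤ c × d ≤ y
  Inside v y c d = Within v y c d × ¬ (c ≡ v × d ≡ y)

  infix 4 _≐_
  _≐_ : (A B : ℕ → ℕ → Set) → Set
  A ≐ B = ∀ {c d} → (A c d → B c d) × (B c d → A c d)

  join : ∀ {v w y} → (w ≡ suc v ⊎ E v w) → v < w → w < y → (∀ u → E v u → u < y → u ≤ w) →
    (E v w → ∃ λ a → Σ (Forest v w (2 + a)) λ G → Edge G ≐ Inside v w) →
    (∃ λ k → Σ (Forest w y k) λ F → Edge F ≐ Within w y) →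
    ∃ λ a → Σ (Forest v y (2 + a)) λ G → Edge G ≐ Inside v y
  join _ _ w<y _ _ (zero , [] , _) = ⊥-elim (<-irrefl refl w<y)
  join {v} {w} {y} (inj₁ refl) v<w w<y max _ (suc k , F , spec) = k , leaf F , to , from
    where
    to : ∀ {c d} → Edge (leaf F) c d → Inside v y c d
    to (skip e) with proj₁ spec e
    ... | p , i , j = (p , ≤-trans (n≤1+n v) i , j) , λ { (refl , _) → <-irrefl refl i }
    from : ∀ {c d} → Inside v y c d → Edge (leaf F) c d
    from {c} {d} ((p , i , j) , ne) with v ≟ c
    ... | no v≢c = skip (proj₂ spec (p , ≤∧≢⇒< i v≢c , j))
    -- By the choice of `w` a segment from `v` other than v─y ends at `suc v` at the latest, too
    -- early for a segment of `E`.
    ... | yes refl = ⊥-elim (<⇒≱ (E-<₂ p) (max d p (≤∧≢⇒< j λ eq → ne (refl , eq))))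
  join {v} {w} {y} (inj₂ q) v<w w<y max strict (suc k , F , spec) with strict q
  ... | a , G , spec′ = k , node a G F , to , from
    where
    to : ∀ {c d} → Edge (node a G F) c d → Inside v y c d
    to here = (q , ≤-refl , <⇒≤ w<y) , λ { (_ , refl) → <-irrefl refl w<y }
    to (below e) with proj₁ spec′ e
    ... | (p , i , j) , _ = (p , i , ≤-trans j (<⇒≤ w<y)) , λ { (_ , refl) → <⇒≱ w<y j }
    to (right e) with proj₁ spec e
    ... | p , i , j = (p , ≤-trans (<⇒≤ v<w) i , j) , λ { (refl , _) → <⇒≱ v<w i }
    under : ∀ {c d} → E c d → v ≤ c → d ≤ w → Edge (node a G F) c d
    under {c} {d} p i j with c ≟ v | d ≟ w
    ... | yes refl | yes refl = here
    ... | no ne | _ = below (proj₂ spec′ ((p , i , j) , λ eq → ne (proj₁ eq)))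
    ... | _ | no ne = below (proj₂ spec′ ((p , i , j) , λ eq → ne (proj₂ eq)))
    from : ∀ {c d} → Inside v y c d → Edge (node a G F) c d
    from {c} {d} ((p , i , j) , ne) with w ≤? c | v ≟ c
    ... | yes w≤c | _ = right (proj₂ spec (p , w≤c , j))
    ... | no _ | yes refl = under p i (max d p (≤∧≢⇒< j λ eq → ne (refl , eq)))
    -- A segment starting strictly between `v` and `w` and ending beyond `w` would cross v─w.
    ... | no w≰c | no v≢c = under p i
          (≮⇒≥ λ w<d → E-noncrossing q p (≤∧≢⇒< i v≢c) (≰⇒> w≰c) w<d)

  -- `n` bounds the length of the interval and makes the recursion structural. `strict` finds the
  -- sides of the region below v─y whether or not v─y is a segment; `whole` then leaves these trees
  -- as roots or puts them under one node, according to that question.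
  strict : ∀ n {v y} → y ≤ n + v → 2 + v ≤ y →
    ∃ λ a → Σ (Forest v y (2 + a)) λ G → Edge G ≐ Inside v y
  whole : ∀ n {v y} → y ≤ n + v → v ≤ y →
    ∃ λ k → Σ (Forest v y k) λ F → Edge F ≐ Within v y

  strict zero h i = ⊥-elim (<⇒≱ (≤-trans (n≤1+n _) i) h)
  strict (suc n) {v} {y} h i
    with greatest (λ w → (w ≟ suc v) ⊎-dec E? v w) y (inj₁ refl) i
  ... | w , p , v<w , w<y , max =
    join p v<w w<y (λ u q → max u (inj₂ q))
      (λ q → strict n (s≤s⁻¹ (≤-trans w<y h)) (E-<₂ q))
      (whole n (≤-trans h (≤-trans (≤-reflexive (sym (+-suc n v))) (+-monoʳ-≤ n v<w))) (<⇒≤ w<y))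

  whole n {v} {y} h i with v ≟ y
  ... | yes refl = 0 , [] , (λ ()) , λ { (p , j , k) → ⊥-elim (<⇒≱ (≤-trans (n≤1+n _) (E-<₂ p)) (≤-trans k j)) }
  ... | no v≢y with y ≟ suc v
  ...   | yes refl = 1 , leaf [] , (λ { (skip ()) }) , λ { (p , j , k) → ⊥-elim (<⇒≱ (E-<₂ p) (≤-trans k (s≤s j))) }
  ...   | no y≢ with strict n h (≤∧≢⇒< (≤∧≢⇒< i v≢y) (λ eq → y≢ (sym eq))) | E? v y
  ...     | a , G , spec | no ¬p = 2 + a , G , (λ e → proj₁ (proj₁ spec e)) ,
              λ q → proj₂ spec (q , λ { (refl , refl) → ¬p (proj₁ q) })
  ...     | a , G , spec | yes p = 1 , node a G [] ,
              (λ { here → p , ≤-refl , ≤-refl ; (below e) → proj₁ (proj₁ spec e) }) , from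
    where
    from : ∀ {c d} → Within v y c d → Edge (node a G []) c d
    from {c} {d} q with c ≟ v | d ≟ y
    ... | yes refl | yes refl = here
    ... | no ne | _ = below (proj₂ spec (q , λ eq → ne (proj₁ eq)))
    ... | _ | no ne = below (proj₂ spec (q , λ eq → ne (proj₂ eq)))

-- The regions are the nodes

least : ∀ {Q : ℕ → Set} → (∀ v → Dec (Q v)) → ∀ n {a b} → b ≤ n + a → Q b → a < b →
  ∃ λ t → Q t × a < t × t ≤ b × (∀ u → Q u → a < u → t ≤ u)
least Q? zero h q i = ⊥-elim (<⇒≱ i h)
least Q? (suc n) {a} {b} h q i with Q? (suc a) | b ≟ suc a
... | yes p | _ = suc a , p , ≤-refl , i , λ u _ j → j
... | no ¬p | yes refl = ⊥-elim (¬p q)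
... | no ¬p | no b≢ with least Q? n (≤-trans h (≤-reflexive (sym (+-suc n a)))) q (≤∧≢⇒< i (λ eq → b≢ (sym eq)))
...   | t , r , j , k , m = t , r , <-trans (n<1+n a) j , k , min
  where
  min : ∀ u → _ → a < u → t ≤ u
  min u p a<u with u ≟ suc a
  ... | yes refl = ⊥-elim (¬p p)
  ... | no u≢ = m u p (≤∧≢⇒< a<u (λ eq → u≢ (sym eq)))

straddle : ∀ {Q : ℕ → Set} → (∀ v → Dec (Q v)) → ∀ {v y m} → Q v → Q y → v ≤ m → m < y →
  ∃ λ t → ∃ λ t′ → Q t × Q t′ × v ≤ t × t ≤ m × m < t′ × t′ ≤ y × Between Q t t′
straddle Q? {v} {y} {m} qv qy i j
  with greatest Q? (suc m) qv (s≤s i) | least Q? y (m≤m+n y m) qy j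
... | t , p , v≤t , s≤s t≤m , max | t′ , p′ , m<t′ , t′≤y , min =
  t , t′ , p , p′ , v≤t , t≤m , m<t′ , t′≤y , btw
  where
  btw : ∀ u → _ → u ≤ t ⊎ t′ ≤ u
  btw u q with u ≤? m
  ... | yes u≤m = inj₁ (max u q (s≤s u≤m))
  ... | no u≰m = inj₂ (min u q (≰⇒> u≰m))

infix 4 _≗ₛ_
_≗ₛ_ : (Q Q′ : ℕ → Set) → Set
Q ≗ₛ Q′ = ∀ v → (Q v → Q′ v) × (Q′ v → Q v)

-- By `H₁` the set `Q` proceeds from `v` to `y` along sides and edges. It cannot jump over the end
-- of the first root: an edge from `v` is at most as long as the root, and one starting properly
-- beneath the root would cross it. So this end belongs to `Q`, by `H₂` nothing of `Q` lies beneath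
-- the root, and the walk continues with the other trees.
walk : ∀ {Q : ℕ → Set} → (∀ v → Dec (Q v)) → ∀ {v y k} (F : Forest v y k) →
  Q v → Q y → (∀ u → Q u → u ≤ y) →
  (∀ {p q} → v ≤ p → Q p → Q q → p < q → Between Q p q → q ≡ suc p ⊎ Edge F p q) →
  (∀ {p q} → Edge F p q → Q p → Q q → Between Q p q) →
  ∀ u → v ≤ u → (Q u → On F u) × (On F u → Q u)
walk Q? [] qv qy ub H₁ H₂ u i = (λ q → ≤-antisym (ub u q) i) , λ { refl → qv }
walk {Q} Q? {v} (leaf F) qv qy ub H₁ H₂ u i = to , from
  where
  q′ : Q (suc v)
  q′ with straddle Q? qv qy ≤-refl (forest-≤ F)
  ... | t , t′ , p , p′ , v≤t , t≤v , v<t′ , t′≤y , btw with ≤-antisym t≤v v≤t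
  ...   | refl with H₁ ≤-refl p p′ v<t′ btw
  ...     | inj₁ refl = p′
  ...     | inj₂ (skip e) = ⊥-elim (<-irrefl refl (edge-≥ e))
  rec : ∀ u → v < u → (Q u → On F u) × (On F u → Q u)
  rec = walk Q? F q′ qy ub
    (λ j p q l b → [ inj₁ , (λ { (skip e) → inj₂ e }) ]′ (H₁ (≤-trans (n≤1+n v) j) p q l b))
    (λ e → H₂ (skip e))
  to : Q u → On (leaf F) u
  to q with u ≟ v
  ... | yes eq = inj₁ eq
  ... | no ne = inj₂ (proj₁ (rec u (≤∧≢⇒< i (λ eq → ne (sym eq)))) q)
  from : On (leaf F) u → Q u
  from (inj₁ refl) = qv
  from (inj₂ o) = proj₂ (rec u (on-≥ F o)) o
walk {Q} Q? {v} {y} (node {z = suc z} a G F) qv qy ub H₁ H₂ u i = to , from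
  where
  v<z : v < suc z
  v<z = forest-< G
  q′ : Q (suc z)
  q′ with straddle Q? qv qy ≤-refl (≤-trans v<z (forest-≤ F))
  ... | t , t′ , p , p′ , v≤t , t≤v , v<t′ , t′≤y , btw with ≤-antisym t≤v v≤t
  ...   | refl with t′ ≤? z
  ...     | no t′≰z with H₁ ≤-refl p p′ v<t′ btw
  ...       | inj₁ refl = subst Q (≤-antisym v<z (≰⇒> t′≰z)) p′
  ...       | inj₂ e = subst Q (≤-antisym (first-edge e) (≰⇒> t′≰z)) p′
  -- The first step from `v` stays beneath the root, whose end is `suc z`. The consecutive members
  -- around `z` then start properly beneath the root, so the right one must be `suc z`.
  q′ | t , t′ , p , p′ , v≤t , t≤v , v<t′ , t′≤y , btw | refl | yes t′≤z
    with straddle Q? p′ qy t′≤z (forest-≤ F)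
  ... | s , s′ , r , r′ , t′≤s , s≤z , z<s′ , s′≤y , btw′
    with H₁ (≤-trans (<⇒≤ v<t′) t′≤s) r r′ (≤-trans (s≤s s≤z) z<s′) btw′ | s′ ≟ suc z
  ...   | _ | yes refl = r′
  ...   | inj₁ refl | no ne = ⊥-elim (ne (≤-antisym (s≤s s≤z) z<s′))
  ...   | inj₂ e | no ne = ⊥-elim (edge-noncrossing (here {G = G} {F}) e
            (<-≤-trans v<t′ t′≤s) (s≤s s≤z) (≤∧≢⇒< z<s′ (λ eq → ne (sym eq))))
  gap : Between Q v (suc z)
  gap = H₂ here qv q′
  rec : ∀ u → suc z ≤ u → (Q u → On F u) × (On F u → Q u)
  rec = walk Q? F q′ qy ub H₁′ (λ e → H₂ (right e))
    where
    H₁′ : ∀ {p q} → suc z ≤ p → Q p → Q q → p < q → Between Q p q → q ≡ suc p ⊎ Edge F p q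
    H₁′ j p q l b with H₁ (≤-trans (<⇒≤ v<z) j) p q l b
    ... | inj₁ eq = inj₁ eq
    ... | inj₂ here = ⊥-elim (<⇒≱ v<z j)
    ... | inj₂ (below e) = ⊥-elim (<⇒≱ l (≤-trans (edge-≤ e) j))
    ... | inj₂ (right e) = inj₂ e
  to : Q u → On (node a G F) u
  to q with gap u q
  ... | inj₁ u≤v = inj₁ (≤-antisym u≤v i)
  ... | inj₂ z≤u = inj₂ (proj₁ (rec u z≤u) q)
  from : On (node a G F) u → Q u
  from (inj₁ refl) = qv
  from (inj₂ o) = proj₂ (rec u (on-≥ F o)) o
walk Q? (node {z = zero} a G F) qv qy ub H₁ H₂ u i with forest-< G
... | ()

SideOf : (ℕ → Set) → ℕ → ℕ → Set
SideOf Q c d = Between Q c d ⊎ (∀ v → Q v → c ≤ v × v ≤ d)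

-- The closing segment of the polygon counts as an edge here.
Region : (ℕ → ℕ → Set) → (ℕ → Set) → Set
Region E Q = ∀ {c d} → Q c → Q d → c < d →
  (SideOf Q c d → d ≡ suc c ⊎ E c d) × (E c d → SideOf Q c d)

-- Consecutive corners are joined by the roots of `sub e`, the two extreme ones by `e`. Conversely,
-- an edge between corners is `e` itself or lies in `sub e`, where `edge-on` applies.
sub-region : ∀ {x y k c d} {T : Forest x y k} (e : Edge T c d) → Region (Edge T) (On (sub e))
sub-region {c = c} {d} {T} e {p} {q} op oq p<q = side , edge
  where
  side : SideOf (On (sub e)) p q → q ≡ suc p ⊎ Edge T p q
  side (inj₁ b) = [ inj₁ , (λ f → inj₂ (sub-edge e f)) ]′ (on-consecutive (sub e) op oq p<q b)
  side (inj₂ w) with ≤-antisym (proj₁ (w c (on-left (sub e)))) (on-≥ (sub e) op)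
                   | ≤-antisym (on-≤ (sub e) oq) (proj₂ (w d (on-right (sub e))))
  ... | refl | refl = inj₂ e
  edge : Edge T p q → SideOf (On (sub e)) p q
  edge f with edge-sub e f (on-≥ (sub e) op) (on-≤ (sub e) oq)
  ... | inj₁ (refl , refl) = inj₂ λ v o → on-≥ (sub e) o , on-≤ (sub e) o
  ... | inj₂ g = inj₁ (edge-on g op oq)

-- All of `Q` lies on one side of c─d, so c─d is an edge, and `walk` identifies `Q` with the
-- boundary of the forest beneath it. The third member `m` keeps c─d from being a polygon side or a
-- step between consecutive members.
region-sub : ∀ {Q : ℕ → Set} → (∀ v → Dec (Q v)) → ∀ {x y k c d m} {T : Forest x y k} →
  Region (Edge T) Q → Q c → Q d → Q m → c < m → m < d → (∀ v → Q v → c ≤ v × v ≤ d) →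
  ∃ λ (e : Edge T c d) → Q ≗ₛ On (sub e)
region-sub {Q} Q? {c = c} {d} {m} {T} R qc qd qm c<m m<d rng with proj₁ (R qc qd (<-trans c<m m<d)) (inj₂ rng)
... | inj₁ refl = ⊥-elim (<⇒≱ m<d c<m)
... | inj₂ e = e , same
  where
  H₁ : ∀ {p q} → c ≤ p → Q p → Q q → p < q → Between Q p q → q ≡ suc p ⊎ Edge (sub e) p q
  H₁ _ qp qq p<q b with proj₁ (R qp qq p<q) (inj₁ b)
  ... | inj₁ eq = inj₁ eq
  ... | inj₂ f with edge-sub e f (proj₁ (rng _ qp)) (proj₂ (rng _ qq))
  ...   | inj₂ g = inj₂ g
  ...   | inj₁ (refl , refl) with b m qm
  ...     | inj₁ m≤c = ⊥-elim (<⇒≱ c<m m≤c)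
  ...     | inj₂ d≤m = ⊥-elim (<⇒≱ m<d d≤m)
  H₂ : ∀ {p q} → Edge (sub e) p q → Q p → Q q → Between Q p q
  H₂ f qp qq with proj₂ (R qp qq (edge-< f)) (sub-edge e f)
  ... | inj₁ b = b
  ... | inj₂ w with ≤-antisym (proj₁ (rng _ qp)) (proj₁ (w c qc)) | ≤-antisym (proj₂ (rng _ qq)) (proj₂ (w d qd))
  ...   | refl | refl = ⊥-elim (edge-proper f)
  W = walk Q? (sub e) qc qd (λ u q → proj₂ (rng u q)) H₁ H₂
  same : Q ≗ₛ On (sub e)
  same v = (λ q → proj₁ (W v (proj₁ (rng v q))) q) , (λ o → proj₂ (W v (on-≥ (sub e) o)) o)

-- Cardinalities as sums of indicators

total : ∀ {k m} → Vec (Vec Bool m) k → ℕ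
total [] = 0
total (r ∷ rs) = countTrue r + total rs

-- The local function of size is not in scope; unification reads it off the goal
-- of size-total, once the table, its rows and their number are distinct variables.
mutual
  size-helper : ∀ m k (D : SegmentSet m) (rs : Vec (Vec Bool m) k) → ℕ
  size-helper = _

  size-total : ∀ {m} (D : SegmentSet m) → size D ≡ total D
  size-total {zero} [] = refl
  size-total {suc m} (r ∷ rs) with r ∷ rs
  ... | D with suc m
  ...   | M = cong (countTrue r +_) (size-helper-total M m D rs)

  size-helper-total : ∀ m k (D : SegmentSet m) (rs : Vec (Vec Bool m) k) → size-helper m k D rs ≡ total rs
  size-helper-total m _ D [] = refl
  size-helper-total m _ D (r ∷ rs) = cong (countTrue r +_) (size-helper-total m _ D rs)

-- Sums over plain numbers allow the entries of a table and the members of a subset to be counted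
-- along the recursive structure of a forest.
Σ< : ℕ → (ℕ → ℕ) → ℕ
Σ< zero f = 0
Σ< (suc n) f = f 0 + Σ< n (λ v → f (suc v))

Σ-cong : ∀ n {f g} → (∀ v → f v ≡ g v) → Σ< n f ≡ Σ< n g
Σ-cong zero h = refl
Σ-cong (suc n) h = cong₂ _+_ (h 0) (Σ-cong n (λ v → h (suc v)))

Σ-+ : ∀ n f g → Σ< n (λ v → f v + g v) ≡ Σ< n f + Σ< n g
Σ-+ zero f g = refl
Σ-+ (suc n) f g = trans (cong (f 0 + g 0 +_) (Σ-+ n _ _)) (interchange (f 0) (g 0) _ _)

Σ-zero : ∀ n {f} → (∀ v → f v ≡ 0) → Σ< n f ≡ 0
Σ-zero zero h = refl
Σ-zero (suc n) h = cong₂ _+_ (h 0) (Σ-zero n (λ v → h (suc v)))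

Σ-point : ∀ n {f} c → c < n → (∀ v → v ≢ c → f v ≡ 0) → Σ< n f ≡ f c
Σ-point (suc n) {f} zero _ h =
  trans (cong (f 0 +_) (Σ-zero n (λ v → h (suc v) λ ()))) (+-identityʳ (f 0))
Σ-point (suc n) (suc c) (s≤s i) h =
  cong₂ _+_ (h 0 λ ()) (Σ-point n c i (λ v ne → h (suc v) λ eq → ne (suc-injective eq)))

ind : ∀ {A : Set} → Dec A → ℕ
ind (yes _) = 1
ind (no _) = 0

ind-cong : ∀ {A B : Set} (A? : Dec A) (B? : Dec B) → (A → B) → (B → A) → ind A? ≡ ind B?
ind-cong (yes a) (yes b) f g = refl
ind-cong (yes a) (no ¬b) f g = ⊥-elim (¬b (f a))
ind-cong (no ¬a) (yes b) f g = ⊥-elim (¬a (g b))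
ind-cong (no ¬a) (no ¬b) f g = refl

ind-⊎ : ∀ {A B C : Set} (A? : Dec A) (B? : Dec B) (C? : Dec C) →
  (A → B ⊎ C) → (B → A) → (C → A) → (B → ¬ C) → ind A? ≡ ind B? + ind C?
ind-⊎ A? (yes b) (yes c) f g h d = ⊥-elim (d b c)
ind-⊎ (yes a) (yes b) (no ¬c) f g h d = refl
ind-⊎ (no ¬a) (yes b) (no ¬c) f g h d = ⊥-elim (¬a (g b))
ind-⊎ (yes a) (no ¬b) (yes c) f g h d = refl
ind-⊎ (no ¬a) (no ¬b) (yes c) f g h d = ⊥-elim (¬a (h c))
ind-⊎ (yes a) (no ¬b) (no ¬c) f g h d = ⊥-elim ([ ¬b , ¬c ]′ (f a))
ind-⊎ (no ¬a) (no ¬b) (no ¬c) f g h d = refl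

ind-yes : ∀ {A : Set} (A? : Dec A) → A → ind A? ≡ 1
ind-yes (yes _) a = refl
ind-yes (no ¬a) a = ⊥-elim (¬a a)

ind-no : ∀ {A : Set} (A? : Dec A) → ¬ A → ind A? ≡ 0
ind-no (yes a) ¬a = ⊥-elim (¬a a)
ind-no (no _) ¬a = refl

countTrue-Σ : ∀ {n} (v : Vec Bool n) {f} → (∀ i → ind (T? (lookup v i)) ≡ f (toℕ i)) → countTrue v ≡ Σ< n f
countTrue-Σ [] h = refl
countTrue-Σ (true ∷ v) h = cong₂ _+_ (h zero) (countTrue-Σ v (λ i → h (suc i)))
countTrue-Σ (false ∷ v) h = cong₂ _+_ (h zero) (countTrue-Σ v (λ i → h (suc i)))

size-Σ : ∀ {m} (D : SegmentSet m) {f : ℕ → ℕ → ℕ} → (∀ i j → ind (T? (lookup (lookup D i) j)) ≡ f (toℕ i) (toℕ j)) →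
  size D ≡ Σ< m (λ c → Σ< m (f c))
size-Σ {m} D {f} h = trans (size-total D) (rows D {f} h)
  where
  rows : ∀ {k} (rs : Vec (Vec Bool m) k) {f : ℕ → ℕ → ℕ} → (∀ i j → ind (T? (lookup (lookup rs i) j)) ≡ f (toℕ i) (toℕ j)) →
    total rs ≡ Σ< k (λ c → Σ< m (f c))
  rows [] h = refl
  rows (r ∷ rs) {f} h = cong₂ _+_ (countTrue-Σ r {f 0} (h zero)) (rows rs {λ c → f (suc c)} (λ i → h (suc i)))

∣∣-Σ : ∀ {n} (S : Subset n) {f} → (∀ i → ind (i ∈? S) ≡ f (toℕ i)) → ∣ S ∣ ≡ Σ< n f
∣∣-Σ [] h = refl
∣∣-Σ (true ∷ S) h = cong₂ _+_ (h zero) (∣∣-Σ S (λ i → trans (ind-cong _ _ there λ { (there p) → p }) (h (suc i))))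
∣∣-Σ (false ∷ S) h = cong₂ _+_ (h zero) (∣∣-Σ S (λ i → trans (ind-cong _ _ there λ { (there p) → p }) (h (suc i))))

Σ-insert : ∀ {P : ℕ → Set} m x (P? : ∀ v → Dec (P v)) (P⁺? : ∀ v → Dec (v ≡ x ⊎ P v)) →
  x < m → ¬ P x → Σ< m (λ v → ind (P⁺? v)) ≡ suc (Σ< m (λ v → ind (P? v)))
Σ-insert m x P? P⁺? x<m ¬p = begin
  Σ< m (λ v → ind (P⁺? v))
    ≡⟨ Σ-cong m (λ v → ind-⊎ (P⁺? v) (v ≟ x) (P? v) id inj₁ inj₂ λ { refl → ¬p }) ⟩
  Σ< m (λ v → ind (v ≟ x) + ind (P? v))
    ≡⟨ Σ-+ m _ _ ⟩
  Σ< m (λ v → ind (v ≟ x)) + Σ< m (λ v → ind (P? v))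
    ≡⟨ cong (_+ Σ< m (λ v → ind (P? v)))
         (trans (Σ-point m x x<m (λ v → ind-no (v ≟ x))) (ind-yes (x ≟ x) refl)) ⟩
  suc (Σ< m (λ v → ind (P? v))) ∎
  where open ≡-Reasoning

Σ-on : ∀ {x y k} (F : Forest x y k) m → y < m → Σ< m (λ v → ind (on? F v)) ≡ suc k
Σ-on {x} [] m x<m = trans (Σ-point m x x<m (λ v → ind-no (v ≟ x))) (ind-yes (x ≟ x) refl)
Σ-on {x} L@(leaf F) m y<m = trans
  (Σ-insert m x (on? F) (on? L) (≤-trans (forest-< L) (<⇒≤ y<m)) (λ o → <-irrefl refl (on-≥ F o)))
  (cong suc (Σ-on F m y<m))
Σ-on {x} N@(node a G F) m y<m = trans
  (Σ-insert m x (on? F) (on? N) (≤-trans (forest-< N) (<⇒≤ y<m)) (λ o → <⇒≱ (forest-< G) (on-≥ F o)))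
  (cong suc (Σ-on F m y<m))

Σ₂-cong : ∀ m {f g : ℕ → ℕ → ℕ} → (∀ c d → f c d ≡ g c d) →
  Σ< m (λ c → Σ< m (f c)) ≡ Σ< m (λ c → Σ< m (g c))
Σ₂-cong m h = Σ-cong m (λ c → Σ-cong m (h c))

Σ₂-+ : ∀ m (f g : ℕ → ℕ → ℕ) → Σ< m (λ c → Σ< m (λ d → f c d + g c d)) ≡
  Σ< m (λ c → Σ< m (f c)) + Σ< m (λ c → Σ< m (g c))
Σ₂-+ m f g = trans (Σ-cong m (λ c → Σ-+ m (f c) (g c))) (Σ-+ m _ _)

Σ-edge : ∀ {x y k} (F : Forest x y k) m → y < m →
  Σ< m (λ c → Σ< m (λ d → ind (edge? F c d))) ≡ nodes (flat F)
Σ-edge [] m h = Σ-zero m (λ c → Σ-zero m (λ d → refl))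
Σ-edge (leaf F) m h = trans
  (Σ₂-cong m (λ c d → ind-cong (edge? (leaf F) c d) (edge? F c d) (λ { (skip e) → e }) skip))
  (Σ-edge F m h)
Σ-edge {x} N@(node {z = z} a G F) m y<m = begin
  Σ< m (λ c → Σ< m (λ d → ind (edge? N c d)))
    ≡⟨ Σ₂-cong m (λ c d → trans
         (ind-⊎ (edge? N c d) (here? c d) (below? c d ⊎-dec edge? F c d) split
           (λ { (refl , refl) → here }) [ below , right ]′
           λ { (refl , refl) → [ edge-proper , (λ e → <⇒≱ (forest-< G) (edge-≥ e)) ]′ })
         (cong (ind (here? c d) +_)
           (ind-⊎ (below? c d ⊎-dec edge? F c d) (below? c d) (edge? F c d) id inj₁ inj₂ edge-below-right))) ⟩
  Σ< m (λ c → Σ< m (λ d → ind (here? c d) + (ind (below? c d) + ind (edge? F c d))))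
    ≡⟨ trans (Σ₂-+ m (λ c d → ind (here? c d)) (λ c d → ind (below? c d) + ind (edge? F c d)))
         (cong (Σ< m (λ c → Σ< m (λ d → ind (here? c d))) +_)
           (Σ₂-+ m (λ c d → ind (below? c d)) (λ c d → ind (edge? F c d)))) ⟩
  Σ< m (λ c → Σ< m (λ d → ind (here? c d))) +
    (Σ< m (λ c → Σ< m (λ d → ind (below? c d))) + Σ< m (λ c → Σ< m (λ d → ind (edge? F c d))))
    ≡⟨ cong₂ _+_ one (cong₂ _+_ (Σ-edge G m z<m) (Σ-edge F m y<m)) ⟩
  1 + (nodes (flat G) + nodes (flat F))
    ≡⟨ cong suc (sym (nodes-++ (flat G) (flat F))) ⟩
  suc (nodes (flat G ++ flat F)) ∎
  where
  open ≡-Reasoning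
  here? : ∀ c d → Dec (c ≡ x × d ≡ z)
  here? c d = (c ≟ x) ×-dec (d ≟ z)
  below? : ∀ c d → Dec (Edge G c d)
  below? = edge? G
  z<m : z < m
  z<m = ≤-trans (s≤s (forest-≤ F)) y<m
  split : ∀ {c d} → Edge N c d → (c ≡ x × d ≡ z) ⊎ (Edge G c d ⊎ Edge F c d)
  split here = inj₁ (refl , refl)
  split (below e) = inj₂ (inj₁ e)
  split (right e) = inj₂ (inj₂ e)
  one : Σ< m (λ c → Σ< m (λ d → ind (here? c d))) ≡ 1
  one = trans (Σ-point m x (<-trans (forest-< G) z<m)
      λ c ne → Σ-zero m λ d → ind-no (here? c d) λ eq → ne (proj₁ eq))
    (trans (Σ-point m z z<m λ d ne → ind-no (here? x d) λ eq → ne (proj₂ eq))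
      (ind-yes (here? x z) (refl , refl)))

∣p∪q∣≤∣p∣+∣q∣ : ∀ {n} (p q : Subset n) → ∣ p ∪ q ∣ ≤ ∣ p ∣ + ∣ q ∣
∣p∪q∣≤∣p∣+∣q∣ [] [] = z≤n
∣p∪q∣≤∣p∣+∣q∣ (true ∷ p) (true ∷ q) =
  s≤s (≤-trans (∣p∪q∣≤∣p∣+∣q∣ p q) (+-monoʳ-≤ ∣ p ∣ (n≤1+n ∣ q ∣)))
∣p∪q∣≤∣p∣+∣q∣ (true ∷ p) (false ∷ q) = s≤s (∣p∪q∣≤∣p∣+∣q∣ p q)
∣p∪q∣≤∣p∣+∣q∣ (false ∷ p) (true ∷ q) =
  ≤-trans (s≤s (∣p∪q∣≤∣p∣+∣q∣ p q)) (≤-reflexive (sym (+-suc ∣ p ∣ ∣ q ∣)))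
∣p∪q∣≤∣p∣+∣q∣ (false ∷ p) (false ∷ q) = ∣p∪q∣≤∣p∣+∣q∣ p q

-- Forests against tables and subsets of vertices

module Polygon {m Y : ℕ} (m≡ : m ≡ suc Y) where

  Draws : ∀ {k} → SegmentSet m → Forest 0 Y k → Set
  Draws D G = ∀ x y → (D ∋ₛ x ─ y → Edge G (toℕ x) (toℕ y)) × (Edge G (toℕ x) (toℕ y) → D ∋ₛ x ─ y)

  Spans : ∀ {c d k} → Subset m → Forest c d k → Set
  Spans S F = ∀ x → (x ∈ₛ S → On F (toℕ x)) × (On F (toℕ x) → x ∈ₛ S)

  toℕ-≤ : (x : Fin m) → toℕ x ≤ Y
  toℕ-≤ x = s≤s⁻¹ (subst (toℕ x <_) m≡ (Finₚ.toℕ<n x))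

  vertex : ∀ {v} → v ≤ Y → ∃ λ (x : Fin m) → toℕ x ≡ v
  vertex {v} h = fromℕ< v<m , Finₚ.toℕ-fromℕ< v<m
    where
    v<m : v < m
    v<m = subst (v <_) (sym m≡) (s≤s h)

  draws-size : ∀ {k D} {G : Forest 0 Y k} → Draws D G → size D ≡ nodes (flat G)
  draws-size {D = D} {G} r = trans
    (size-Σ D {λ c d → ind (edge? G c d)} λ x y → ind-cong (T? _) (edge? G _ _) (proj₁ (r x y)) (proj₂ (r x y)))
    (Σ-edge G m (≤-reflexive (sym m≡)))

  spans-size : ∀ {c d k S} {F : Forest c d k} → d ≤ Y → Spans S F → ∣ S ∣ ≡ suc k
  spans-size {S = S} {F} h r = trans
    (∣∣-Σ S {λ v → ind (on? F v)} λ x → ind-cong (x ∈? S) (on? F _) (proj₁ (r x)) (proj₂ (r x)))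
    (Σ-on F m (≤-trans (s≤s h) (≤-reflexive (sym m≡))))

  drawing : ∀ {k} → Forest 0 Y k → SegmentSet m
  drawing G = tabulate λ x → tabulate λ y → ⌊ edge? G (toℕ x) (toℕ y) ⌋

  drawing-draws : ∀ {k} (G : Forest 0 Y k) → Draws (drawing G) G
  drawing-draws G x y = (λ t → toWitness (subst T eq t)) , (λ e → subst T (sym eq) (fromWitness e))
    where
    eq : lookup (lookup (drawing G) x) y ≡ ⌊ edge? G (toℕ x) (toℕ y) ⌋
    eq = trans (cong (λ r → lookup r y) (lookup∘tabulate _ x)) (lookup∘tabulate _ y)

  span : ∀ {c d k} → Forest c d k → Subset m
  span F = tabulate λ x → ⌊ on? F (toℕ x) ⌋

  ∈⇒T : ∀ {n} {S : Subset n} {x} → x ∈ₛ S → T (lookup S x)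
  ∈⇒T p = subst T (sym ([]=⇒lookup p)) tt

  T⇒∈ : ∀ {n} {S : Subset n} {x} → T (lookup S x) → x ∈ₛ S
  T⇒∈ {S = S} {x} t with lookup S x in eq
  ... | true = lookup⇒[]= x S eq

  span-spans : ∀ {c d k} (F : Forest c d k) → Spans (span F) F
  span-spans F x = (λ p → toWitness (subst T eq (∈⇒T p))) , (λ o → T⇒∈ (subst T (sym eq) (fromWitness o)))
    where
    eq : lookup (span F) x ≡ ⌊ on? F (toℕ x) ⌋
    eq = lookup∘tabulate _ x

  T-ext : ∀ {a b} → (T a → T b) → (T b → T a) → a ≡ b
  T-ext {true} {true} f g = refl
  T-ext {true} {false} f g = ⊥-elim (f tt)
  T-ext {false} {true} f g = ⊥-elim (g tt)
  T-ext {false} {false} f g = refl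

  vec-ext : ∀ {A : Set} {n} {u v : Vec A n} → (∀ x → lookup u x ≡ lookup v x) → u ≡ v
  vec-ext {u = u} {v} h = trans (sym (tabulate∘lookup u)) (trans (tabulate-cong h) (tabulate∘lookup v))

  draws-unique : ∀ {k D D′} {G : Forest 0 Y k} → Draws D G → Draws D′ G → D ≡ D′
  draws-unique r r′ = vec-ext λ x → vec-ext λ y → T-ext
    (λ t → proj₂ (r′ x y) (proj₁ (r x y) t)) (λ t → proj₂ (r x y) (proj₁ (r′ x y) t))

  spans-unique : ∀ {c d k S S′} {F : Forest c d k} → Spans S F → Spans S′ F → S ≡ S′
  spans-unique r r′ = vec-ext λ x → T-ext
    (λ t → ∈⇒T (proj₂ (r′ x) (proj₁ (r x) (T⇒∈ t)))) (λ t → ∈⇒T (proj₂ (r x) (proj₁ (r′ x) (T⇒∈ t))))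

  draws-⊆ : ∀ {k k′ D} {G : Forest 0 Y k} {G′ : Forest 0 Y k′} → Draws D G → Draws D G′ →
    ∀ {c d} → Edge G c d → Edge G′ c d
  draws-⊆ r r′ e with vertex (≤-trans (<⇒≤ (edge-< e)) (edge-≤ e)) | vertex (edge-≤ e)
  ... | x , refl | y , refl = proj₁ (r′ x y) (proj₂ (r x y) e)

  draws-determine : ∀ {k k′ D} {G : Forest 0 Y k} {G′ : Forest 0 Y k′} → Draws D G → Draws D G′ →
    _≡_ {A = ∃ (Forest 0 Y)} (k , G) (k′ , G′)
  draws-determine {D = D} r r′ =
    edges-determine _ _ (draws-⊆ {D = D} r r′) (draws-⊆ {D = D} r′ r)

  spans-⊆ : ∀ {c d k c′ d′ k′ S} {F : Forest c d k} {F′ : Forest c′ d′ k′} → d ≤ Y → Spans S F → Spans S F′ →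
    ∀ {v} → On F v → On F′ v
  spans-⊆ {F = F} h r r′ o with vertex (≤-trans (on-≤ F o) h)
  ... | x , refl = proj₁ (r′ x) (proj₂ (r x) o)

  spans-ends : ∀ {c d k c′ d′ k′ S} {F : Forest c d k} {F′ : Forest c′ d′ k′} → d ≤ Y → d′ ≤ Y →
    Spans S F → Spans S F′ → c ≡ c′ × d ≡ d′
  spans-ends {F = F} {F′} h h′ r r′ =
    ≤-antisym (on-≥ F (f′ (on-left F′))) (on-≥ F′ (f (on-left F))) ,
    ≤-antisym (on-≤ F′ (f (on-right F))) (on-≤ F (f′ (on-right F′)))
    where
    f : ∀ {v} → On F v → On F′ v
    f = spans-⊆ h r r′
    f′ : ∀ {v} → On F′ v → On F v
    f′ = spans-⊆ h′ r′ r

  draws-dissection : ∀ {k D} {G : Forest 0 Y (2 + k)} → Draws D G → IsDissection m (nodes (flat G)) D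
  draws-dissection {D = D} {G} r = diagonal , noncrossing , draws-size {D = D} {G} r
    where
    diagonal : ∀ x y → D ∋ₛ x ─ y → IsDiagonal x y
    diagonal x y t = edge-< e , λ
      { (inj₁ eq) → <⇒≱ (edge-<₂ e) (≤-reflexive eq)
      ; (inj₂ (p , q)) → edge-proper (subst₂ (Edge G) p (suc-injective (trans q m≡)) e) }
      where e = proj₁ (r x y) t
    noncrossing : ∀ a b c d → D ∋ₛ a ─ b → D ∋ₛ c ─ d → ¬ Cross a b c d
    noncrossing a b c d s t (inj₁ (p , q , u)) =
      edge-noncrossing (proj₁ (r a b) s) (proj₁ (r c d) t) p q u
    noncrossing a b c d s t (inj₂ (p , q , u)) =
      edge-noncrossing (proj₁ (r c d) t) (proj₁ (r a b) s) p q u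

  dissection-draws : ∀ {i D} → 2 ≤ Y → IsDissection m i D → ∃ λ a → Σ (Forest 0 Y (2 + a)) (Draws D)
  dissection-draws {i} {D} 2≤Y (diagonal , noncrossing , _) =
    let a , G , spec = strict Y (≤-reflexive (sym (+-identityʳ Y))) 2≤Y in
    a , G , λ x y →
      (λ t → proj₂ spec (((x , y , t , refl , refl) , z≤n , toℕ-≤ y) ,
        λ { (p , q) → proj₂ (diagonal x y t) (inj₂ (p , trans (cong suc q) (sym m≡))) })) ,
      λ e → back (proj₁ (proj₁ (proj₁ spec e)))
    where
    E : ℕ → ℕ → Set
    E c d = ∃ λ x → ∃ λ y → D ∋ₛ x ─ y × toℕ x ≡ c × toℕ y ≡ d
    E? : ∀ c d → Dec (E c d)
    E? c d = Finₚ.any? λ x → Finₚ.any? λ y → T? _ ×-dec ((toℕ x ≟ c) ×-dec (toℕ y ≟ d))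
    E-<₂ : ∀ {c d} → E c d → 2 + c ≤ d
    E-<₂ (x , y , t , refl , refl) with diagonal x y t
    ... | x<y , ns = ≤∧≢⇒< x<y λ eq → ns (inj₁ (sym eq))
    E-noncrossing : ∀ {a b c d} → E a b → E c d → a < c → c < b → b < d → ⊥
    E-noncrossing (x , y , t , refl , refl) (x′ , y′ , t′ , refl , refl) p q r =
      noncrossing x y x′ y′ t t′ (inj₁ (p , q , r))
    back : ∀ {x y} → E (toℕ x) (toℕ y) → D ∋ₛ x ─ y
    back (x , y , t , p , q) with Finₚ.toℕ-injective p | Finₚ.toℕ-injective q
    ... | refl | refl = t
    open Dissect E E? E-<₂ E-noncrossing

  Member : Subset m → ℕ → Set
  Member S v = ∃ λ x → x ∈ₛ S × toℕ x ≡ v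

  member? : ∀ S v → Dec (Member S v)
  member? S v = Finₚ.any? λ x → (x ∈? S) ×-dec (toℕ x ≟ v)

  member : ∀ {S x} → Member S (toℕ x) → x ∈ₛ S
  member (x , p , eq) with Finₚ.toℕ-injective eq
  ... | refl = p

  side⇒ : ∀ {S x y} → IsSideOf S x y → SideOf (Member S) (toℕ x) (toℕ y)
  side⇒ (inj₁ b) = inj₁ λ { _ (z , p , refl) → b z p }
  side⇒ (inj₂ w) = inj₂ λ { _ (z , p , refl) → w z p }

  side⇐ : ∀ {S x y} → SideOf (Member S) (toℕ x) (toℕ y) → IsSideOf S x y
  side⇐ (inj₁ b) = inj₁ λ z p → b _ (z , p , refl)
  side⇐ (inj₂ w) = inj₂ λ z p → w _ (z , p , refl)

  module _ {a : ℕ} {D : SegmentSet m} {G : Forest 0 Y (2 + a)} (r : Draws D G) where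

    -- The side 0─Y is not a diagonal. As a root it turns the region at this side into a node like
    -- any other.
    Tree : Forest 0 Y 1
    Tree = node a G []

    region⇒ : ∀ {S} → IsRegion D S → Region (Edge Tree) (Member S)
    region⇒ {S} (_ , h) (x , p , refl) (y , q , refl) x<y = side , edge
      where
      side : SideOf (Member S) (toℕ x) (toℕ y) → toℕ y ≡ suc (toℕ x) ⊎ Edge Tree (toℕ x) (toℕ y)
      side s with proj₁ (h x y p q x<y) (side⇐ s)
      ... | inj₁ (inj₁ eq) = inj₁ eq
      ... | inj₁ (inj₂ (i , j)) = inj₂ (subst₂ (Edge Tree) (sym i) (sym (suc-injective (trans j m≡))) here)
      ... | inj₂ t = inj₂ (below (proj₁ (r x y) t))
      edge : Edge Tree (toℕ x) (toℕ y) → SideOf (Member S) (toℕ x) (toℕ y)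
      edge e = side⇒ (edge′ e refl refl)
        where
        edge′ : ∀ {c d} → Edge Tree c d → c ≡ toℕ x → d ≡ toℕ y → IsSideOf S x y
        edge′ here i j = inj₂ λ z _ → ≤-trans (≤-reflexive (sym i)) z≤n , ≤-trans (toℕ-≤ z) (≤-reflexive j)
        edge′ (below e) refl refl = proj₂ (h x y p q x<y) (proj₂ (r x y) e)

    region⇐ : ∀ {S} → 3 ≤ ∣ S ∣ → Region (Edge Tree) (Member S) → IsRegion D S
    region⇐ {S} h R = h , λ x y p q x<y →
      let s , t = R (x , p , refl) (y , q , refl) x<y in
      (λ w → [ (λ eq → inj₁ (inj₁ eq)) , (λ e → edge e refl refl) ]′ (s (side⇒ w))) ,
      λ w → side⇐ (t (below (proj₁ (r x y) w)))
      where
      edge : ∀ {x y c d} → Edge Tree c d → c ≡ toℕ x → d ≡ toℕ y → IsPolygonSide x y ⊎ D ∋ₛ x ─ y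
      edge here i j = inj₁ (inj₂ (sym i , trans (cong suc (sym j)) (sym m≡)))
      edge (below e) refl refl = inj₂ (proj₂ (r _ _) e)

    spans-region : ∀ {S c d} (e : Edge Tree c d) → Spans S (sub e) → IsRegion D S
    spans-region {S} e t = region⇐
      (subst (3 ≤_) (sym (spans-size {F = sub e} (edge-≤ e) t)) (s≤s (s≤s (s≤s z≤n))))
      λ { (x , p , refl) (y , q , refl) x<y →
        let s , w = sub-region e (proj₁ (t x) p) (proj₁ (t y) q) x<y in
        (λ { (inj₁ b) → s (inj₁ λ v o → b v (mem o)) ; (inj₂ b) → s (inj₂ λ v o → b v (mem o)) }) ,
        λ f → [ (λ b → inj₁ λ { v (z , u , refl) → b v (proj₁ (t z) u) })
              , (λ b → inj₂ λ { v (z , u , refl) → b v (proj₁ (t z) u) }) ]′ (w f) }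
      where
      mem : ∀ {v} → On (sub e) v → Member S v
      mem o with vertex (≤-trans (on-≤ (sub e) o) (edge-≤ e))
      ... | x , refl = x , proj₂ (t x) o , refl

    -- Without a member strictly between the extremes, `S` would be contained in a set of two
    -- elements.
    ends : ∀ {S} → 3 ≤ ∣ S ∣ → ∃ λ x → ∃ λ y → ∃ λ z → x ∈ₛ S × y ∈ₛ S × z ∈ₛ S ×
      toℕ x < toℕ z × toℕ z < toℕ y × (∀ w → w ∈ₛ S → toℕ x ≤ toℕ w × toℕ w ≤ toℕ y)
    ends {S} h with nonempty? S
    ... | no ¬ne = ⊥-elim (<⇒≱ h (≤-trans
            (p⊆q⇒∣p∣≤∣q∣ {q = ∅} (λ {x} p → ⊥-elim (¬ne (x , p)))) (≤-trans (≤-reflexive (∣⊥∣≡0 m)) z≤n)))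
    ... | yes (w , p) with minimum | maximum
      where
      pos : ¬ Member S 0 → ∀ u → u ∈ₛ S → 0 < toℕ u
      pos ¬q u i with toℕ u in eq
      ... | zero = ⊥-elim (¬q (u , i , eq))
      ... | suc _ = s≤s z≤n
      minimum : ∃ λ x → x ∈ₛ S × (∀ u → u ∈ₛ S → toℕ x ≤ toℕ u)
      minimum with member? S 0
      ... | yes (x , q , eq) = x , q , λ u _ → ≤-trans (≤-reflexive eq) z≤n
      ... | no ¬q with least (member? S) (toℕ w) (≤-reflexive (sym (+-identityʳ (toℕ w)))) (w , p , refl) (pos ¬q w p)
      ...   | _ , (x , q , refl) , _ , _ , min = x , q , λ u i → min _ (u , i , refl) (pos ¬q u i)
      maximum : ∃ λ y → y ∈ₛ S × (∀ u → u ∈ₛ S → toℕ u ≤ toℕ y)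
      maximum with greatest (member? S) m (w , p , refl) (Finₚ.toℕ<n w)
      ... | _ , (y , q , refl) , _ , _ , max = y , q , λ u i → max _ (u , i , refl) (Finₚ.toℕ<n u)
    ...   | x , x∈ , min | y , y∈ , max
        with Finₚ.any? (λ z → (z ∈? S) ×-dec ((toℕ x <? toℕ z) ×-dec (toℕ z <? toℕ y)))
    ...     | yes (z , z∈ , x<z , z<y) = x , y , z , x∈ , y∈ , z∈ , x<z , z<y , λ u i → min u i , max u i
    ...     | no ¬z = ⊥-elim (<⇒≱ h (≤-trans (p⊆q⇒∣p∣≤∣q∣ S⊆) (≤-trans (∣p∪q∣≤∣p∣+∣q∣ ⁅ x ⁆ ⁅ y ⁆)
                (≤-reflexive (cong₂ _+_ (∣⁅x⁆∣≡1 x) (∣⁅x⁆∣≡1 y))))))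
      where
      S⊆ : ∀ {z} → z ∈ₛ S → z ∈ₛ ⁅ x ⁆ ∪ ⁅ y ⁆
      S⊆ {z} i with x Finₚ.≟ z | y Finₚ.≟ z
      ... | yes refl | _ = x∈p∪q⁺ (inj₁ (x∈⁅x⁆ x))
      ... | _ | yes refl = x∈p∪q⁺ {p = ⁅ x ⁆} (inj₂ (x∈⁅x⁆ y))
      ... | no x≢z | no y≢z = ⊥-elim (¬z (z , i ,
            ≤∧≢⇒< (min z i) (λ eq → x≢z (Finₚ.toℕ-injective eq)) ,
            ≤∧≢⇒< (max z i) (λ eq → y≢z (Finₚ.toℕ-injective (sym eq)))))

    region-spans : ∀ {S} → IsRegion D S → ∃₂ λ c d → ∃ λ (e : Edge Tree c d) → Spans S (sub e)
    region-spans {S} R with ends (proj₁ R)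
    ... | x , y , z , x∈ , y∈ , z∈ , x<z , z<y , rng
      with region-sub (member? S) (region⇒ R) (x , x∈ , refl) (y , y∈ , refl) (z , z∈ , refl) x<z z<y
             (λ { _ (w , i , refl) → rng w i })
    ... | e , same = _ , _ , e , λ w →
          (λ i → proj₁ (same (toℕ w)) (w , i , refl)) , (λ o → member (proj₂ (same (toℕ w)) o))

-- Binary sequences as compositions

-- A label `b` stands for the part `suc b` of a composition of `n`. The part of the chosen region is
-- kept apart as the block in front of the first one of `ε`, so `b + gaps bs` is `n - 1`, the length
-- of `ε`.
gaps : ∀ {i} → Vec ℕ i → ℕ
gaps [] = 0
gaps (b ∷ bs) = suc b + gaps bs

-- ε is 0^b 1 0^b₁ 1 0^b₂ …
data Gaps : ∀ {i l} → ℕ → Vec ℕ i → Vec Bool l → Set where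
  done : Gaps 0 [] []
  zero : ∀ {i l b} {bs : Vec ℕ i} {ε : Vec Bool l} → Gaps b bs ε → Gaps (suc b) bs (false ∷ ε)
  one : ∀ {i l b} {bs : Vec ℕ i} {ε : Vec Bool l} → Gaps b bs ε → Gaps 0 (b ∷ bs) (true ∷ ε)

gaps-of : ∀ {i l} (ε : Vec Bool l) → countTrue ε ≡ i → ∃ λ b → Σ (Vec ℕ i) λ bs → Gaps b bs ε
gaps-of [] refl = 0 , [] , done
gaps-of (true ∷ ε) refl = let b , bs , g = gaps-of ε refl in 0 , b ∷ bs , one g
gaps-of (false ∷ ε) eq = let b , bs , g = gaps-of ε eq in suc b , bs , zero g

gaps-word : ∀ {i} b (bs : Vec ℕ i) {l} → b + gaps bs ≡ l → Σ (Vec Bool l) λ ε → Gaps b bs ε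
gaps-word zero [] refl = [] , done
gaps-word zero (b ∷ bs) refl = let ε , g = gaps-word b bs refl in true ∷ ε , one g
gaps-word (suc b) bs refl = let ε , g = gaps-word b bs refl in false ∷ ε , zero g

gaps-count : ∀ {i l b} {bs : Vec ℕ i} {ε : Vec Bool l} → Gaps b bs ε → countTrue ε ≡ i
gaps-count done = refl
gaps-count (zero g) = gaps-count g
gaps-count (one g) = cong suc (gaps-count g)

gaps-sum : ∀ {i l b} {bs : Vec ℕ i} {ε : Vec Bool l} → Gaps b bs ε → b + gaps bs ≡ l
gaps-sum done = refl
gaps-sum (zero g) = cong suc (gaps-sum g)
gaps-sum (one g) = cong suc (gaps-sum g)

gaps-functional : ∀ {i l b} {bs : Vec ℕ i} {ε ε′ : Vec Bool l} → Gaps b bs ε → Gaps b bs ε′ → ε ≡ ε′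
gaps-functional done done = refl
gaps-functional (zero g) (zero h) = cong (false ∷_) (gaps-functional g h)
gaps-functional (one g) (one h) = cong (true ∷_) (gaps-functional g h)

gaps-injective : ∀ {i l b b′} {bs bs′ : Vec ℕ i} {ε : Vec Bool l} → Gaps b bs ε → Gaps b′ bs′ ε →
  b ≡ b′ × bs ≡ bs′
gaps-injective done done = refl , refl
gaps-injective (zero g) (zero h) with gaps-injective g h
... | refl , refl = refl , refl
gaps-injective (one g) (one h) with gaps-injective g h
... | refl , refl = refl , refl

-- Words as positions and labels of their nodes

-- With s = 1 + s′ and j = 1 + b, a region with sj + 2 sides is a node with
-- 2 + arity s′ b children.
arity : ℕ → ℕ → ℕ
arity s′ b = b + s′ * suc b

arity-injective : ∀ s′ {b c} → arity s′ b ≡ arity s′ c → b ≡ c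
arity-injective s′ {b} {c} eq = suc-injective (*-cancelˡ-≡ (suc b) (suc c) (suc s′) (cong suc eq))

Increasing : ∀ {i} → ℕ → ℕ → Vec ℕ i → Set
Increasing p q a = (∀ k → (p ≤ lookup a k) × (lookup a k ≤ q))
                 × (∀ k l → k F.≤ l → lookup a k ≤ lookup a l)

module _ (s′ : ℕ) where

  -- The letters of w are read from position p on, a leaf moving one position
  -- ahead; a and bs list the positions and the labels of the nodes.
  data Code : ∀ {i} → ℕ → Vec ℕ i → Vec ℕ i → Word → ℕ → Set where
    done : ∀ {q} → Code q [] [] [] q
    leaf : ∀ {i p q w} {a bs : Vec ℕ i} → Code (suc p) a bs w q → Code p a bs (nothing ∷ w) q
    node : ∀ {i p q b w} {a bs : Vec ℕ i} → Code p a bs w q →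
      Code p (p ∷ a) (b ∷ bs) (just (arity s′ b) ∷ w) q

  code-leaves : ∀ {i p q w} {a bs : Vec ℕ i} → Code p a bs w q → p + leaves w ≡ q
  code-leaves {p = p} done = +-identityʳ p
  code-leaves {p = p} (leaf {w = w} c) = trans (+-suc p (leaves w)) (code-leaves c)
  code-leaves (node c) = code-leaves c

  code-≤ : ∀ {i p q w} {a bs : Vec ℕ i} → Code p a bs w q → p ≤ q
  code-≤ {p = p} c = ≤-trans (m≤m+n p _) (≤-reflexive (code-leaves c))

  code-nodes : ∀ {i p q w} {a bs : Vec ℕ i} → Code p a bs w q → nodes w ≡ i
  code-nodes done = refl
  code-nodes (leaf c) = code-nodes c
  code-nodes (node c) = cong suc (code-nodes c)

  code-weight : ∀ {i p q w} {a bs : Vec ℕ i} → Code p a bs w q → weight w ≡ suc s′ * gaps bs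
  code-weight done = sym (*-zeroʳ (suc s′))
  code-weight (leaf c) = code-weight c
  code-weight (node {b = b} {bs = bs} c) =
    trans (cong (suc s′ * suc b +_) (code-weight c)) (sym (*-distribˡ-+ (suc s′) (suc b) (gaps bs)))

  code-arity : ∀ {i p q w} {a bs : Vec ℕ i} → Code p a bs w q → ∀ {k} → just k ∈ˡ w → ∃ λ b → k ≡ arity s′ b
  code-arity (leaf c) (there k∈) = code-arity c k∈
  code-arity (node c) (here refl) = _ , refl
  code-arity (node c) (there k∈) = code-arity c k∈

  code-increasing : ∀ {i p q w} {a bs : Vec ℕ i} → Code p a bs w q → Increasing p q a
  code-increasing done = (λ ()) , λ ()
  code-increasing {p = p} (leaf c) with code-increasing c
  ... | r , mono = (λ k → ≤-trans (n≤1+n p) (proj₁ (r k)) , proj₂ (r k)) , mono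
  code-increasing {p = p} {q} (node {a = a} c) with code-increasing c
  ... | r , mono = range , mono′
    where
    range : ∀ k → (p ≤ lookup (p ∷ a) k) × (lookup (p ∷ a) k ≤ q)
    range zero = ≤-refl , code-≤ c
    range (suc k) = r k
    mono′ : ∀ k l → k F.≤ l → lookup (p ∷ a) k ≤ lookup (p ∷ a) l
    mono′ zero zero h = ≤-refl
    mono′ zero (suc l) h = proj₁ (r l)
    mono′ (suc k) (suc l) (s≤s h) = mono k l h

  -- `d` counts the leaves still to be written. `code-exists` writes the nodes placed at `p`; once
  -- none is left, all positions exceed `p` and `code-exists-from` can advance by a leaf.
  code-exists : ∀ {i} d {p q} (a bs : Vec ℕ i) → p + d ≡ q → Increasing p q a → ∃ λ w → Code p a bs w q
  code-exists-from : ∀ {i} d {p q} (a bs : Vec ℕ i) → p + d ≡ q → Increasing (suc p) q a → ∃ λ w → Code p a bs w q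

  code-exists d [] [] eq inc = code-exists-from d [] [] eq ((λ ()) , λ ())
  code-exists d {p} (x ∷ a) (b ∷ bs) eq (r , mono) with p ≟ x
  ... | yes refl = let w , c = code-exists d a bs eq
                         ((λ k → mono zero (suc k) z≤n , proj₂ (r (suc k))) , λ k l h → mono (suc k) (suc l) (s≤s h))
                   in _ , node c
  ... | no p≢x = code-exists-from d (x ∷ a) (b ∷ bs) eq
        ((λ { zero → x> , proj₂ (r zero)
            ; (suc k) → ≤-trans x> (mono zero (suc k) z≤n) , proj₂ (r (suc k)) }) , mono)
    where
    x> : p < x
    x> = ≤∧≢⇒< (proj₁ (r zero)) p≢x
  code-exists-from zero {p} [] [] eq inc with trans (sym (+-identityʳ p)) eq
  ... | refl = [] , done
  code-exists-from zero {p} (x ∷ a) bs eq (r , _) =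
    ⊥-elim (<⇒≱ (proj₁ (r zero)) (≤-trans (proj₂ (r zero)) (≤-reflexive (trans (sym eq) (+-identityʳ p)))))
  code-exists-from (suc d) {p} a bs eq inc =
    let w , c = code-exists d a bs (trans (sym (+-suc p d)) eq) inc in _ , leaf c

  encode : ∀ w {i p q} → nodes w ≡ i → p + leaves w ≡ q → (∀ {k} → just k ∈ˡ w → ∃ λ b → k ≡ arity s′ b) →
    Σ (Vec ℕ i) λ a → Σ (Vec ℕ i) λ bs → Code p a bs w q
  encode [] {p = p} refl eq h with trans (sym (+-identityʳ p)) eq
  ... | refl = [] , [] , done
  encode (nothing ∷ w) {p = p} n eq h =
    let a , bs , c = encode w n (trans (sym (+-suc p _)) eq) (λ k∈ → h (there k∈)) in a , bs , leaf c
  encode (just k ∷ w) {p = p} refl eq h with h (here refl)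
  ... | b , refl = let a , bs , c = encode w refl eq (λ k∈ → h (there k∈)) in p ∷ a , b ∷ bs , node c

  code-functional : ∀ {i p q w w′} {a bs : Vec ℕ i} → Code p a bs w q → Code p a bs w′ q → w ≡ w′
  code-functional done done = refl
  code-functional done (leaf c) = ⊥-elim (<-irrefl refl (code-≤ c))
  code-functional (leaf c) done = ⊥-elim (<-irrefl refl (code-≤ c))
  code-functional (leaf c) (leaf c′) = cong (nothing ∷_) (code-functional c c′)
  code-functional (leaf c) (node _) = ⊥-elim (<-irrefl refl (proj₁ (proj₁ (code-increasing c) zero)))
  code-functional (node _) (leaf c) = ⊥-elim (<-irrefl refl (proj₁ (proj₁ (code-increasing c) zero)))
  code-functional (node c) (node c′) = cong (_ ∷_) (code-functional c c′)

  code-injective : ∀ {i p q w w′} {a a′ bs bs′ : Vec ℕ i} → w ≡ w′ → Code p a bs w q → Code p a′ bs′ w′ q →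
    a ≡ a′ × bs ≡ bs′
  code-injective eq done done = refl , refl
  code-injective refl (leaf c) (leaf c′) = code-injective refl c c′
  code-injective eq (node {b = b} c) (node {b = b′} c′) with ∷-injective eq
  ... | eq₁ , eq₂ with arity-injective s′ {b} {b′} (just-injective eq₁) | code-injective eq₂ c c′
  ...   | refl | refl , refl = refl , refl

-- Decidability, by which the irrelevant proofs in a `Refinement` are recomputed

∀Subset? : ∀ {m} {P : Subset m → Set} → (∀ S → Dec (P S)) → Dec (∀ S → P S)
∀Subset? P? = map′
  (λ ¬∃ S → decidable-stable (P? S) λ ¬p → ¬∃ (S , ¬p)) (λ h → λ { (S , ¬p) → ¬p (h S) })
  (¬? (anySubset? λ S → ¬? (P? S)))

isPolygonSide? : ∀ {m} (x y : Fin m) → Dec (IsPolygonSide x y)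
isPolygonSide? {m} x y = (toℕ y ≟ suc (toℕ x)) ⊎-dec ((toℕ x ≟ 0) ×-dec (suc (toℕ y) ≟ m))

isDissection? : ∀ m i D → Dec (IsDissection m i D)
isDissection? m i D =
  (Finₚ.all? λ x → Finₚ.all? λ y → T? _ →-dec ((x F.<? y) ×-dec ¬? (isPolygonSide? x y))) ×-dec
  ((Finₚ.all? λ a → Finₚ.all? λ b → Finₚ.all? λ c → Finₚ.all? λ d → T? _ →-dec (T? _ →-dec
    ¬? (((a F.<? c) ×-dec ((c F.<? b) ×-dec (b F.<? d))) ⊎-dec ((c F.<? a) ×-dec ((a F.<? d) ×-dec (d F.<? b)))))) ×-dec
  (size D ≟ i))

isSideOf? : ∀ {m} (S : Subset m) x y → Dec (IsSideOf S x y)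
isSideOf? S x y =
  (Finₚ.all? λ z → (z ∈? S) →-dec ((z F.≤? x) ⊎-dec (y F.≤? z))) ⊎-dec
  (Finₚ.all? λ z → (z ∈? S) →-dec ((x F.≤? z) ×-dec (z F.≤? y)))

isRegion? : ∀ {m} (D : SegmentSet m) S → Dec (IsRegion D S)
isRegion? D S = (3 ≤? ∣ S ∣) ×-dec
  (Finₚ.all? λ x → Finₚ.all? λ y → (x ∈? S) →-dec ((y ∈? S) →-dec ((x F.<? y) →-dec
    ((isSideOf? S x y →-dec (isPolygonSide? x y ⊎-dec T? _)) ×-dec (T? _ →-dec isSideOf? S x y)))))

bounded-∃? : ∀ n {Q : ℕ → Set} → (∀ j → Dec (Q j)) → Dec (Σ ℕ λ j → (1 ≤ j) × (j ≤ n) × Q j)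
bounded-∃? n Q? = map′ (λ { (j , s≤s h , i , q) → j , i , h , q }) (λ { (j , i , h , q) → j , s≤s h , i , q })
  (anyUpTo? (λ j → (1 ≤? j) ×-dec Q? j) (suc n))

increasing? : ∀ {i} p q (a : Vec ℕ i) → Dec (Increasing p q a)
increasing? p q a =
  (Finₚ.all? λ k → (p ≤? lookup a k) ×-dec (lookup a k ≤? q)) ×-dec
  (Finₚ.all? λ k → Finₚ.all? λ l → (k F.≤? l) →-dec (lookup a k ≤? lookup a l))

value-injective : ∀ {A : Set} {P : A → Set} {x y : Refinement A P} → value x ≡ value y → x ≡ y
value-injective refl = refl

relation⇒⤖ : ∀ {A B : Set} (R : A → B → Set) → (∀ a → ∃ λ b → R a b) → (∀ b → ∃ λ a → R a b) →
  (∀ {a b b′} → R a b → R a b′ → b ≡ b′) → (∀ {a a′ b} → R a b → R a′ b → a ≡ a′) → A ⤖ B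
relation⇒⤖ {A} {B} R total onto functional injective = mk⤖ {to = to}
  ( (λ {a} {a′} eq → injective (proj₂ (total a)) (subst (R a′) (sym eq) (proj₂ (total a′))))
  , λ b → let a , r = onto b in a , λ { refl → functional (proj₂ (total a)) r })
  where
  to : A → B
  to a = proj₁ (total a)

-- The correspondence and its bijectivity

module Correspondence (s′ n′ i : ℕ) {Y m : ℕ} (Y≡ : Y ≡ suc s′ * suc n′ + 1) (m≡ : m ≡ suc Y) where

  s n : ℕ
  s = suc s′
  n = suc n′

  open Polygon m≡

  -- The graph of the bijection. The rotated word `post e ++ pre e` has `Y` leaves, hence `Y + 1`
  -- places for its nodes: numbered from 1, the last place is `m`, which is `s * n + 2` in the
  -- theorem.
  record Related (D : SegmentSet m) (R : Subset m) (a : Vec ℕ i) (ε : Vec Bool n′) : Set where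
    constructor related
    field
      {k} : ℕ
      {G} : Forest 0 Y (2 + k)
      draws : Draws D G
      {c d} : ℕ
      e : Edge (node k G []) c d
      spans : Spans R (sub e)
      {b} : ℕ
      {bs} : Vec ℕ i
      gap : Gaps b bs ε
      label≡ : label e ≡ arity s′ b
      code : Code s′ 1 a bs (post e ++ pre e) m

  related-functional : ∀ {D R a a′ ε ε′} → Related D R a ε → Related D R a′ ε′ → a ≡ a′ × ε ≡ ε′
  related-functional {D} (related {G = G} r e t {b} g l co) (related {G = G′} r′ e′ t′ {b′} g′ l′ co′)
    with draws-determine {D = D} {G} {G′} r r′
  ... | refl with spans-ends {F = sub e} {sub e′} (edge-≤ e) (edge-≤ e′) t t′
  ...   | refl , refl with edge-unique e e′
  ...     | refl with code-injective s′ refl co co′ | arity-injective s′ {b} {b′} (trans (sym l) l′)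
  ...       | refl , refl | refl = refl , gaps-functional g g′

  -- The uniqueness half of the cycle lemma, carried over to trees: `split-unique` restores the cut
  -- of the rotated word, the resulting preorder word gives the tree, and the length of its front
  -- part the node.
  rotation-determines : ∀ {k k′ c d c′ d′} {G : Forest 0 Y (2 + k)} {G′ : Forest 0 Y (2 + k′)}
    (e : Edge (node k G []) c d) (e′ : Edge (node k′ G′ []) c′ d′) →
    label e ≡ label e′ → post e ++ pre e ≡ post e′ ++ pre e′ →
    _≡_ {A = ∃ λ k → Σ (Forest 0 Y (2 + k)) λ G → ∃₂ λ c d → Edge (node k G []) c d}
      (k , G , c , d , e) (k′ , G′ , c′ , d′ , e′)
  rotation-determines {k} {k′} {G = G} {G′} e e′ l h = same (flat-injective (node k G []) (node k′ G′ [])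
      (trans (flat-edge e) (trans (cong₂ (λ u v → u ++ v) (proj₂ pieces)
        (cong₂ (λ a v → just a ∷ v) l (proj₁ pieces))) (sym (flat-edge e′)))))
    where
    pieces : post e ≡ post e′ × pre e ≡ pre e′
    pieces = split-unique {label e} h
      (subst (λ w → Run 1 w 0) (flat-edge e) (flat-Run₀ (node k G [])))
      (subst (λ w → Run 1 w 0) (trans (flat-edge e′) (cong (λ a → pre e′ ++ just a ∷ post e′) (sym l)))
        (flat-Run₀ (node k′ G′ [])))
    same : node k G [] ≡ node k′ G′ [] → _
    same refl with pre-injective e e′ (proj₂ pieces)
    ... | refl = refl

  related-injective : ∀ {D D′ R R′ a ε} → Related D R a ε → Related D′ R′ a ε → D ≡ D′ × R ≡ R′
  related-injective (related {G = G} r e t g l co) (related {G = G′} r′ e′ t′ g′ l′ co′)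
    with gaps-injective g g′
  ... | refl , refl with rotation-determines e e′ (trans l (sym l′)) (code-functional s′ co co′)
  ...   | refl = draws-unique {G = G} r r′ , spans-unique {F = sub e} t t′

  Valid : SegmentSet m → Set
  Valid D = ∀ S → IsRegion D S → Σ ℕ λ j → (1 ≤ j) × (j ≤ n) × (∣ S ∣ ≡ s * j + 2)

  3+arity : ∀ b → 3 + arity s′ b ≡ s * suc b + 2
  3+arity b = sym (+-comm (s * suc b) 2)

  -- An additive count does not notice a rotation. Applied to `leaves`, `nodes` and `weight`, this
  -- reduces the rotated word to the whole tree without the chosen letter.
  rotate : ∀ {x y k c d} {F : Forest x y k} (f : Word → ℕ) → (∀ u v → f (u ++ v) ≡ f u + f v) → (e : Edge F c d) →
    f (flat F) ≡ f (just (label e) ∷ []) + f (post e ++ pre e)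
  rotate f f-++ e = begin
    f _                                            ≡⟨ cong f (flat-edge e) ⟩
    f (pre e ++ just (label e) ∷ post e)           ≡⟨ f-++ (pre e) _ ⟩
    f (pre e) + f (just (label e) ∷ post e)        ≡⟨ +-comm (f (pre e)) _ ⟩
    f (just (label e) ∷ post e) + f (pre e)        ≡⟨ sym (f-++ (just (label e) ∷ post e) (pre e)) ⟩
    f (just (label e) ∷ post e ++ pre e)           ≡⟨ f-++ (just (label e) ∷ []) _ ⟩
    f (just (label e) ∷ []) + f (post e ++ pre e)  ∎
    where open ≡-Reasoning

  -- A tree has one leaf more than its weight, and its leaves are the sides other than 0─Y. Where
  -- every region contributes some `s * j` to the weight, cancelling `s` makes the `j` sum to `n`.
  tree-weight : ∀ {k} (G : Forest 0 Y (2 + k)) → weight (flat (node k G [])) ≡ s * n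
  tree-weight {k} G = suc-injective (begin
    1 + weight (flat (node k G []))  ≡⟨ sym (Run-weight (flat-Run₀ (node k G []))) ⟩
    leaves (flat (node k G []))      ≡⟨ flat-leaves (node k G []) ⟩
    Y                                ≡⟨ Y≡ ⟩
    s * n + 1                        ≡⟨ +-comm (s * n) 1 ⟩
    1 + s * n                        ∎)
    where open ≡-Reasoning

  letter⇒edge : ∀ {x y k l} {F : Forest x y k} → just l ∈ˡ flat F → ∃₂ λ c d → Σ (Edge F c d) λ e → label e ≡ l
  letter⇒edge {F = F} l∈ with ∈-∃++ l∈
  ... | u , v , eq with flat-letter F u eq
  ...   | c , d , e , _ , p , _ = c , d , e , p

  edge⇒letter : ∀ {x y k c d} {F : Forest x y k} (e : Edge F c d) → just (label e) ∈ˡ flat F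
  edge⇒letter e = subst (just (label e) ∈ˡ_) (sym (flat-edge e)) (∈-++⁺ʳ (pre e) (here refl))

  rotated-letter : ∀ {x y k c d l} {F : Forest x y k} (e : Edge F c d) → l ∈ˡ post e ++ pre e → l ∈ˡ flat F
  rotated-letter {l = l} e l∈ with ∈-++⁻ (post e) l∈
  ... | inj₁ p = subst (l ∈ˡ_) (sym (flat-edge e)) (∈-++⁺ʳ (pre e) (there p))
  ... | inj₂ p = subst (l ∈ˡ_) (sym (flat-edge e)) (∈-++⁺ˡ p)

  related-total : ∀ {D R} → IsDissection m i D → Valid D → IsRegion D R →
    ∃ λ a → ∃ λ ε → Related D R a ε × Increasing 1 m a × countTrue ε ≡ i
  related-total {D} {R} dis valid reg
    with dissection-draws {D = D} (subst (2 ≤_) (sym Y≡) (+-monoˡ-≤ 1 {1} {s * n} (s≤s z≤n))) dis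
  ... | k , G , r with region-spans {D = D} r reg
  ...   | c , d , e , t = a , ε , related r e t g (proj₂ lab) co , code-increasing s′ co , gaps-count g
    where
    labels : ∀ {l} → just l ∈ˡ flat (node k G []) → ∃ λ b → l ≡ arity s′ b
    labels l∈ with letter⇒edge l∈
    ... | _ , _ , f , l≡ with valid (span (sub f)) (spans-region {D = D} r f (span-spans (sub f)))
    -- The region below `f` has `3 + label f` sides: `f` itself and the `2 + label f` children.
    ...   | suc b , _ , _ , eq = b , trans (sym l≡) (+-cancelˡ-≡ 3 _ _
            (trans (sym (spans-size {F = sub f} (edge-≤ f) (span-spans (sub f)))) (trans eq (sym (3+arity b)))))
    lab : ∃ λ b → label e ≡ arity s′ b
    lab = labels (edge⇒letter e)
    b = proj₁ lab
    enc = encode s′ (post e ++ pre e) {i} {1} {m}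
      -- Both sides count all regions but one: the rotated word lacks the letter of the chosen
      -- region, the diagonals lack the added root 0─Y.
      (suc-injective (trans (sym (rotate nodes nodes-++ e))
        (cong suc (trans (cong nodes (++-identityʳ (flat G)))
          (trans (sym (draws-size {D = D} {G} r)) (proj₂ (proj₂ dis)))))))
      (trans (cong suc (trans (sym (rotate leaves leaves-++ e)) (flat-leaves (node k G [])))) (sym m≡))
      (λ l∈ → labels (rotated-letter e l∈))
    a = proj₁ enc
    bs = proj₁ (proj₂ enc)
    co = proj₂ (proj₂ enc)
    sum : b + gaps bs ≡ n′
    sum = suc-injective (*-cancelˡ-≡ (suc (b + gaps bs)) n s (begin
      s * (suc b + gaps bs)                   ≡⟨ *-distribˡ-+ s (suc b) (gaps bs) ⟩
      s * suc b + s * gaps bs                 ≡⟨ cong₂ (λ l w → suc l + w) (sym (proj₂ lab)) (sym (code-weight s′ co)) ⟩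
      suc (label e) + weight (post e ++ pre e)
        ≡⟨ cong (_+ weight (post e ++ pre e)) (sym (+-identityʳ (suc (label e)))) ⟩
      suc (label e) + 0 + weight (post e ++ pre e)  ≡⟨ sym (rotate weight weight-++ e) ⟩
      weight (flat (node k G []))             ≡⟨ tree-weight G ⟩
      s * n                                   ∎))
      where open ≡-Reasoning
    gw = gaps-word b bs sum
    ε = proj₁ gw
    g = proj₂ gw

  tree-of : ∀ {w} → leaves w ≡ Y → Run 1 w 0 → Σ (Forest 0 Y 1) λ F → flat F ≡ w
  tree-of h r with parse 0 r
  ... | y , F , refl with trans (sym (flat-leaves F)) h
  ...   | refl = F , refl

  no-edge : ∀ {x y c d} {F : Forest x y 0} → ¬ Edge F c d
  no-edge {F = []} ()

  related-onto : ∀ {a ε} → Increasing 1 m a → countTrue ε ≡ i →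
    ∃ λ D → ∃ λ R → Related D R a ε × IsDissection m i D × Valid D × IsRegion D R
  related-onto {a} {ε} inc cnt with gaps-of ε cnt
  ... | b , bs , g with code-exists s′ Y a bs (sym m≡) inc
  ...   | w , co with cycle-lemma (arity s′ b) w leaves-w
    where
    open ≡-Reasoning
    leaves-w : leaves w ≡ 2 + arity s′ b + weight w
    leaves-w = begin
      leaves w                            ≡⟨ suc-injective (trans (code-leaves s′ co) m≡) ⟩
      Y                                   ≡⟨ Y≡ ⟩
      s * n + 1                           ≡⟨ +-comm (s * n) 1 ⟩
      suc (s * suc n′)                    ≡⟨ cong (λ t → suc (s * suc t)) (sym (gaps-sum g)) ⟩
      suc (s * (suc b + gaps bs))         ≡⟨ cong suc (*-distribˡ-+ s (suc b) (gaps bs)) ⟩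
      suc (s * suc b + s * gaps bs)       ≡⟨ cong (λ t → suc (s * suc b + t)) (sym (code-weight s′ co)) ⟩
      2 + arity s′ b + weight w           ∎
  ...     | v , u , refl , run with tree-of leaves-T run
    where
    leaves-T : leaves (u ++ just (arity s′ b) ∷ v) ≡ Y
    leaves-T = begin
      leaves (u ++ just (arity s′ b) ∷ v)  ≡⟨ leaves-++ u _ ⟩
      leaves u + leaves v                  ≡⟨ +-comm (leaves u) _ ⟩
      leaves v + leaves u                  ≡⟨ sym (leaves-++ v u) ⟩
      leaves (v ++ u)                      ≡⟨ suc-injective (trans (code-leaves s′ co) m≡) ⟩
      Y                                    ∎
      where open ≡-Reasoning
  ...       | F , flat≡ with flat-letter F u flat≡
  -- The tree word contains the letter of the chosen region, so the tree is not a single leaf.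
  related-onto {a} {ε} inc cnt | b , bs , g | _ , co | v , u , refl , run | leaf _ , flat≡ | _ , _ , skip e , _ = ⊥-elim (no-edge e)
  related-onto {a} {ε} inc cnt | b , bs , g | _ , co | v , u , refl , run | node k G [] , flat≡ | c , d , e , refl , lab , refl =
    drawing G , span (sub e) , related r e t g lab co ,
    subst (λ j → IsDissection m j (drawing G)) nodes-G (draws-dissection {D = drawing G} {G} r) , valid , spans-region {D = drawing G} r e t
    where
    r : Draws (drawing G) G
    r = drawing-draws G
    t : Spans (span (sub e)) (sub e)
    t = span-spans (sub e)
    nodes-G : nodes (flat G) ≡ i
    nodes-G = trans (sym (cong nodes (++-identityʳ (flat G))))
      (suc-injective (trans (rotate nodes nodes-++ e) (cong suc (code-nodes s′ co))))
    labels : ∀ {c d} (f : Edge (node k G []) c d) → ∃ λ b → label f ≡ arity s′ b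
    labels f with ∈-++⁻ (pre e) (subst (just (label f) ∈ˡ_) (flat-edge e) (edge⇒letter f))
    ... | inj₁ p = code-arity s′ co (∈-++⁺ʳ (post e) p)
    ... | inj₂ (here eq) = b , trans (just-injective eq) lab
    ... | inj₂ (there p) = code-arity s′ co (∈-++⁺ˡ p)
    valid : Valid (drawing G)
    valid S R with region-spans {D = drawing G} r R
    ... | _ , _ , f , t′ with labels f
    ...   | b′ , eq = suc b′ , s≤s z≤n , *-cancelˡ-≤ s bound ,
            trans (spans-size {F = sub f} (edge-≤ f) t′) (trans (cong (3 +_) eq) (3+arity b′))
      where
      open ≤-Reasoning
      -- One region weighs at most as much as the whole tree, and exactly as much when there is no
      -- diagonal; then `j` is `n`.
      bound : s * suc b′ ≤ s * n
      bound = begin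
        s * suc b′                              ≡⟨ cong suc (sym eq) ⟩
        suc (label f)                           ≤⟨ m≤m+n _ _ ⟩
        suc (label f) + 0                       ≤⟨ m≤m+n _ _ ⟩
        suc (label f) + 0 + weight (post f ++ pre f)  ≡⟨ sym (rotate weight weight-++ f) ⟩
        weight (flat (node k G []))             ≡⟨ tree-weight G ⟩
        s * n                                   ∎

  IsMarked : SegmentSet m → Subset m → Set
  IsMarked D R = IsDissection m i D × Valid D × IsRegion D R

  isMarked? : ∀ D R → Dec (IsMarked D R)
  isMarked? D R = isDissection? m i D ×-dec
    (∀Subset? (λ S → isRegion? D S →-dec bounded-∃? n (λ j → ∣ S ∣ ≟ s * j + 2)) ×-dec isRegion? D R)

  MarkedDissection : Set
  MarkedDissection = Refinement (SegmentSet m × Subset m) λ DR → IsMarked (proj₁ DR) (proj₂ DR)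

  Rel : MarkedDissection → WeakSeq i m × BinSeq n i → Set
  Rel p (a , ε) = Related (proj₁ (value p)) (proj₂ (value p)) (value a) (value ε)

  rel-total : ∀ p → ∃ (Rel p)
  rel-total ((D , R) Refinement., [ h ]) = refine (image (recompute (isMarked? D R) h))
    where
    image : IsMarked D R → ∃₂ λ a ε → Related D R a ε × Increasing 1 m a × countTrue ε ≡ i
    image (dis , valid , reg) = related-total dis valid reg
    refine : (∃₂ λ a ε → Related D R a ε × Increasing 1 m a × countTrue ε ≡ i) →
      ∃ (Rel ((D , R) Refinement., [ h ]))
    refine (a , ε , rel , inc , cnt) = ((a Refinement., [ inc ]) , (ε Refinement., [ cnt ])) , rel

  rel-onto : ∀ q → ∃ λ p → Rel p q
  rel-onto q@((a Refinement., [ inc ]) , (ε Refinement., [ cnt ])) =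
    refine (related-onto (recompute (increasing? 1 m a) inc) (recompute (countTrue ε ≟ i) cnt))
    where
    refine : (∃₂ λ D R → Related D R a ε × IsMarked D R) → ∃ λ p → Rel p q
    refine (D , R , rel , marked) = ((D , R) Refinement., [ marked ]) , rel

  rel-functional : ∀ {p q q′} → Rel p q → Rel p q′ → q ≡ q′
  rel-functional {p} {q} {q′} r r′ = glue (related-functional {proj₁ (value p)} {proj₂ (value p)} r r′)
    where
    glue : value (proj₁ q) ≡ value (proj₁ q′) × value (proj₂ q) ≡ value (proj₂ q′) → q ≡ q′
    glue (a≡ , ε≡) = cong₂ _,_ (value-injective {x = proj₁ q} {proj₁ q′} a≡) (value-injective {x = proj₂ q} {proj₂ q′} ε≡)

  rel-injective : ∀ {p p′ q} → Rel p q → Rel p′ q → p ≡ p′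
  rel-injective {p} {p′} r r′ = glue (related-injective {proj₁ (value p)} {proj₁ (value p′)} r r′)
    where
    glue : proj₁ (value p) ≡ proj₁ (value p′) × proj₂ (value p) ≡ proj₂ (value p′) → p ≡ p′
    glue (D≡ , R≡) = value-injective {x = p} {p′} (cong₂ _,_ D≡ R≡)

  bijection : MarkedDissection ⤖ (WeakSeq i m × BinSeq n i)
  bijection = relation⇒⤖ Rel rel-total rel-onto
    (λ {p} {q} {q′} → rel-functional {p} {q} {q′}) (λ {p} {p′} {q} → rel-injective {p} {p′} {q})

theorem1 : (s n i : ℕ) → 1 ≤ s → 1 ≤ n →
    P s n i ⤖ (WeakSeq i (s * n + 2) × BinSeq n i)
theorem1 (suc s′) (suc n′) i _ _ = Correspondence.bijection s′ n′ i refl (+-suc (suc s′ * suc n′) 1)
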